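{- For every finite simple graph $G$ the following are equivalent. (1) $G$ is line $[B,B]$-perfect. (2) $G$ is line $[A,B]$-perfect. (3) $G$ is line $[A,-]$-perfect. (4) Neither $P_5$ nor $C_4$ is an edge-induced subgraph of $G$. (5) Every component of $G$ is a vase of flowers, a double star, or an isolated vertex.
   Context: All graphs are finite and simple; two edges are adjacent if they share an endpoint. For $X\in\{A,B\}$, $Y\in\{A,B,-\}$ and $k\in\mathbb N$, the $[X,Y]$-edge colouring game with $k$ colours on a graph $G$ is played by Alice (A) and Bob (B), who alternately colour a previously uncoloured edge with one of the $k$ colours so that adjacent edges always get distinct colours; player $X$ moves first; if $Y\in\{A,B\}$, only player $Y$ may skip any of his/her moves, and if $Y=-$ no player may skip. The game ends when no move is possible; Alice wins iff all edges are coloured. $\chi'_{[X,Y]}(G)$ is the least $k\ge0$ for which Alice has a winning strategy. $\omega(L(G))$ is the maximum number of pairwise adjacent edges of $G$. An edge-induced subgraph of $G$ is a subgraph formed by a subset of the edges together with their endpoints; "$H$ is an edge-induced subgraph of $G$" means $G$ has one isomorphic to $H$. $G$ is line $[X,Y]$-perfect if $\chi'_{[X,Y]}(H)=\omega(L(H))$ for every edge-induced subgraph $H$ of $G$. $P_n$, $C_n$: path and cycle on $n$ vertices. A vase of $n$ flowers ($n\in\mathbb N$) is a triangle $w_1w_2w_3$ plus $n$ leaves attached to $w_1$. An $(m,n)$-double star ($m,n\in\mathbb N$) is an edge $w_1w_2$ plus $m$ leaves attached to $w_1$ and $n$ leaves attached to $w_2$. -}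

module Defs where

open import Data.Nat using (ℕ; zero; suc; _+_; _≤_; _<_; _≡ᵇ_; _≤ᵇ_; _<ᵇ_)
open import Data.Bool using (Bool; true; false; _∨_; _∧_; if_then_else_)
open import Data.Bool.Properties using (∨-comm)
open import Data.Fin using (Fin; toℕ; _≟_)
import Data.Fin as F
open import Data.Maybe using (Maybe; just; nothing)
open import Data.Product using (Σ; ∃; _×_; _,_; proj₁; proj₂)
open import Data.Sum using (_⊎_)
open import Data.List using (List; length)
open import Data.List.Relation.Unary.All using (All)
open import Data.List.Relation.Unary.AllPairs using (AllPairs)
open import Function.Definitions using (Injective)
open import Function.Bundles using (_⇔_)
open import Relation.Nullary using (¬_)
open import Relation.Nullary.Decidable using (⌊_⌋)
open import Relation.Binary.PropositionalEquality using (_≡_; _≢_; refl; cong₂; trans)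

record Graph : Set where
  field
    n   : ℕ
    adj : Fin n → Fin n → Bool
    sym : ∀ u v → adj u v ≡ adj v u
    irr : ∀ u → adj u u ≡ false
open Graph public

mkGraph : (m : ℕ) (e : ℕ → ℕ → Bool) → (∀ a → e a a ≡ false) → Graph
mkGraph m e e-irr = record
  { n   = m
  ; adj = λ i j → e (toℕ i) (toℕ j) ∨ e (toℕ j) (toℕ i)
  ; sym = λ i j → ∨-comm (e (toℕ i) (toℕ j)) (e (toℕ j) (toℕ i))
  ; irr = λ i → irr-lem (e (toℕ i) (toℕ i)) (e-irr (toℕ i))
  }
  where
  irr-lem : ∀ b → b ≡ false → b ∨ b ≡ false
  irr-lem .false refl = refl

pathE : ℕ → ℕ → Bool
pathE a b = suc a ≡ᵇ b

pathE-irr : ∀ a → pathE a a ≡ false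
pathE-irr zero = refl
pathE-irr (suc a) = pathE-irr a

P : ℕ → Graph
P m = mkGraph m pathE pathE-irr

c4E : ℕ → ℕ → Bool
c4E 0 1 = true
c4E 1 2 = true
c4E 2 3 = true
c4E 0 3 = true
c4E _ _ = false

c4E-irr : ∀ a → c4E a a ≡ false
c4E-irr 0 = refl
c4E-irr 1 = refl
c4E-irr 2 = refl
c4E-irr 3 = refl
c4E-irr (suc (suc (suc (suc a)))) = refl

C4 : Graph
C4 = mkGraph 4 c4E c4E-irr

-- vase of m flowers: triangle w1 w2 w3 = 0 1 2, leaves 3,…,m+2 attached to 0
vaseE : ℕ → ℕ → Bool
vaseE 0 1 = true
vaseE 0 2 = true
vaseE 1 2 = true
vaseE 0 (suc (suc (suc _))) = true
vaseE _ _ = false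

vaseE-irr : ∀ a → vaseE a a ≡ false
vaseE-irr 0 = refl
vaseE-irr 1 = refl
vaseE-irr 2 = refl
vaseE-irr (suc (suc (suc a))) = refl

Vase : ℕ → Graph
Vase m = mkGraph (3 + m) vaseE vaseE-irr

-- (m,k)-double star: edge w1 w2 = 0 1, leaves 2,…,m+1 attached to 0,
-- leaves m+2,…,m+k+1 attached to 1
dsE : ℕ → ℕ → ℕ → ℕ → Bool
dsE m k 0 b = (b ≡ᵇ 1) ∨ ((2 ≤ᵇ b) ∧ (b <ᵇ 2 + m))
dsE m k 1 b = (2 + m ≤ᵇ b) ∧ (b <ᵇ 2 + m + k)
dsE m k _ _ = false

dsE-irr : ∀ m k a → dsE m k a a ≡ false
dsE-irr m k 0 = refl
dsE-irr m k 1 = refl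
dsE-irr m k (suc (suc a)) = refl

DoubleStar : ℕ → ℕ → Graph
DoubleStar m k = mkGraph (2 + m + k) (dsE m k) (dsE-irr m k)

K1 : Graph
K1 = mkGraph 1 (λ _ _ → false) (λ _ → refl)

-- Edge-induced subgraphs.
-- H is (isomorphic to) an edge-induced subgraph of G iff there is an
-- injective vertex map sending edges to edges and H has no isolated
-- vertex (the subgraph of G formed by the image edges and their
-- endpoints is then isomorphic to H via the map).

EdgeInducedSub : Graph → Graph → Set
EdgeInducedSub H G =
  Σ (Fin (n H) → Fin (n G)) λ f →
    Injective _≡_ _≡_ f
    × (∀ i j → adj H i j ≡ true → adj G (f i) (f j) ≡ true)
    × (∀ i → ∃ λ j → adj H i j ≡ true)

-- Clique number of the line graph: maximum number of pairwise adjacent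
-- (distinct) edges.  Edges are represented as pairs (u , v) with u < v.

IsEdge : (G : Graph) → Fin (n G) × Fin (n G) → Set
IsEdge G (u , v) = u F.< v × adj G u v ≡ true

ShareEnd : ∀ {m} → Fin m × Fin m → Fin m × Fin m → Set
ShareEnd (u , v) (x , y) = u ≡ x ⊎ u ≡ y ⊎ v ≡ x ⊎ v ≡ y

DistinctAdjacent : ∀ {m} → Fin m × Fin m → Fin m × Fin m → Set
DistinctAdjacent e f = e ≢ f × ShareEnd e f

IsEdgeClique : (G : Graph) → List (Fin (n G) × Fin (n G)) → Set
IsEdgeClique G es = All (IsEdge G) es × AllPairs DistinctAdjacent es

IsOmegaL : Graph → ℕ → Set
IsOmegaL G w =
  (∃ λ es → IsEdgeClique G es × length es ≡ w)
  × (∀ es → IsEdgeClique G es → length es ≤ w)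

data Player : Set where
  A B : Player

-- partial edge colouring with k colours (stored symmetrically)
Col : Graph → ℕ → Set
Col G k = Fin (n G) → Fin (n G) → Maybe (Fin k)

empty : (G : Graph) (k : ℕ) → Col G k
empty G k _ _ = nothing

record Move (G : Graph) (k : ℕ) (c : Col G k) : Set where
  constructor move
  field
    u v   : Fin (n G)
    u<v   : u F.< v
    edge  : adj G u v ≡ true
    fresh : c u v ≡ nothing
    a     : Fin k
    okU   : ∀ w → c u w ≢ just a
    okV   : ∀ w → c v w ≢ just a

play : ∀ {G k} (c : Col G k) → Move G k c → Col G k
play c (move u v _ _ _ a _ _) x y =
  if (⌊ x ≟ u ⌋ ∧ ⌊ y ≟ v ⌋) ∨ (⌊ x ≟ v ⌋ ∧ ⌊ y ≟ u ⌋) then just a else c x y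

AllColoured : ∀ {G k} → Col G k → Set
AllColoured {G} c = ∀ u v → adj G u v ≡ true → ∃ λ a → c u v ≡ just a

-- Wins G k Y p c : Alice has a winning strategy from position c with
-- player p to move, in the game where only Y may skip (Y = nothing: no
-- one may skip).  The game ends when no colouring move is possible;
-- Alice wins iff then every edge is coloured.
data Wins (G : Graph) (k : ℕ) (Y : Maybe Player) : Player → Col G k → Set where
  finished : ∀ {p c} → AllColoured {G} c → Wins G k Y p c
  aMove    : ∀ {c} (m : Move G k c) → Wins G k Y B (play c m) → Wins G k Y A c
  aSkip    : ∀ {c} → Y ≡ just A → Wins G k Y B c → Wins G k Y A c
  bTurn    : ∀ {c} → Move G k c
           → (∀ (m : Move G k c) → Wins G k Y A (play c m))
           → (Y ≡ just B → Wins G k Y A c)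
           → Wins G k Y B c

AliceWins : Player → Maybe Player → Graph → ℕ → Set
AliceWins X Y G k = Wins G k Y X (empty G k)

IsGameChromaticIndex : Player → Maybe Player → Graph → ℕ → Set
IsGameChromaticIndex X Y G k =
  AliceWins X Y G k × (∀ j → j < k → ¬ AliceWins X Y G j)

LinePerfect : Player → Maybe Player → Graph → Set
LinePerfect X Y G =
  ∀ (H : Graph) → EdgeInducedSub H G →
    ∀ w → IsOmegaL H w → IsGameChromaticIndex X Y H w

data Reach (G : Graph) : Fin (n G) → Fin (n G) → Set where
  here : ∀ {u} → Reach G u u
  step : ∀ {u v w} → Reach G u v → adj G v w ≡ true → Reach G u w

ComponentIso : (G : Graph) → Fin (n G) → Graph → Set
ComponentIso G u H =
  Σ (Fin (n H) → Fin (n G)) λ f →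
    Injective _≡_ _≡_ f
    × (∀ i → Reach G u (f i))
    × (∀ v → Reach G u v → ∃ λ i → f i ≡ v)
    × (∀ i j → adj H i j ≡ adj G (f i) (f j))

EveryComponentVaseDoubleStarOrK1 : Graph → Set
EveryComponentVaseDoubleStarOrK1 G =
  ∀ u → (∃ λ m → ComponentIso G u (Vase m))
      ⊎ (∃ λ m → ∃ λ k → ComponentIso G u (DoubleStar m k))
      ⊎ ComponentIso G u K1

{-# OPTIONS --safe #-}
-- With neither P₅ nor C₄ present, every edge with two non-pendant ends is the centre of a double
-- star or lies in a triangle with at most one vertex having further neighbours, all of them pendant;
-- this determines the components.  On such a graph Alice survives with ω(L(G)) colours, component
-- by component.  In a double star she colours the centre edge before or right after the first leaf
-- edge.  In a vase with apex a and base edge bc she answers a spoke by the other spoke, and copies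
-- the colour of a leaf edge to bc or that of bc to a leaf edge: in both cases some colour occurs
-- twice around each uncoloured spoke.  When Bob forces nothing, she may open an untouched double
-- star with its centre edge and an untouched vase with a spoke, but not with bc.  Conversely, with
-- two colours on P₅ or C₄, every first move of Alice is an end edge of a three-edge path, whose
-- other end edge Bob gives the other colour.

module Submission where

open import Defs
open import Data.Bool using (true; false; _∧_; if_then_else_)
import Data.Bool.Properties as Bool
open import Data.Empty using (⊥; ⊥-elim)
open import Data.Fin using (Fin; zero; suc; _≟_; toℕ; _↑ˡ_; _↑ʳ_; splitAt; opposite)
import Data.Fin as F
open import Data.Fin.Properties
  using (all?; any?; ¬∀⟶∃¬; injective⇒≤; <-cmp; toℕ<n; toℕ-↑ˡ; toℕ-↑ʳ;
         splitAt-↑ˡ; splitAt-↑ʳ; splitAt⁻¹-↑ˡ; splitAt⁻¹-↑ʳ)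
open import Data.List
  using (List; []; _∷_; length; map; filter; catMaybes; allFin; cartesianProduct; lookup)
open import Data.List.Membership.Propositional using (_∈_; _∉_)
open import Data.List.Membership.Propositional.Properties
  using (∈-lookup; ∈-filter⁺; ∈-filter⁻; ∈-allFin; ∈-cartesianProduct⁺)
open import Data.List.Properties using (length-map; length-tabulate; length-catMaybes; filter-notAll)
open import Data.List.Relation.Unary.All as All using (All; []; _∷_)
import Data.List.Relation.Unary.All.Properties as All
open import Data.List.Relation.Unary.AllPairs as AllPairs using (AllPairs; []; _∷_)
import Data.List.Relation.Unary.AllPairs.Properties as AllPairs
open import Data.List.Relation.Unary.Any as Any using (index)
open import Data.List.Relation.Unary.Any.Properties using (lookup-index)
open import Data.List.Relation.Unary.Unique.Propositional using (Unique)
import Data.List.Relation.Unary.Unique.Propositional.Properties as Unique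
open import Data.Maybe using (just; nothing)
open import Data.Maybe.Properties using (just-injective) renaming (≡-dec to Maybe-≡-dec)
open import Data.Nat using (ℕ; suc; _+_; _≤_; _<_; _<ᵇ_; z≤n; s≤s; _/_)
open import Data.Nat.DivMod using (_mod_)
open import Data.Nat.Properties
  using (_<?_; ≤-trans; ≤-reflexive; ≤-<-trans; <⇒≱; ≤⇒≯; 1+n≰n; <-asym; m≤m+n; +-monoʳ-<; +-comm)
open import Data.Product using (Σ; ∃; ∃₂; _×_; _,_; proj₁; proj₂)
open import Data.Product.Properties using () renaming (≡-dec to ×-≡-dec)
open import Data.Sum using (_⊎_; inj₁; inj₂; [_,_]′; swap)
open import Function using (_∘_; id)
open import Function.Bundles using (_⇔_; mk⇔)
open import Function.Definitions using (Injective)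
open import Relation.Binary using (Symmetric; tri<; tri≈; tri>)
open import Relation.Binary.PropositionalEquality
  using (_≡_; _≢_; refl; trans; cong; cong₂; subst) renaming (sym to ≡-sym)
open import Relation.Nullary using (¬_; Dec; yes; no; contradiction)
open import Relation.Nullary.Decidable
  using (_×-dec_; _⊎-dec_; _→-dec_; ¬?; dec-true; dec-false; from-yes)
open import Relation.Unary using (Decidable)

-- Only the game in which Bob starts and may skip needs a strategy: his skip on the first turn gives
-- the game that Alice opens, and forgetting his skips gives the game without any. The lower bound
-- is common to all variants, since a win leaves a complete proper colouring, in which pairwise
-- adjacent edges have distinct colours. The obstacle is that Alice may not skip. Every position she
-- hands over must withstand one move of Bob, and must also allow her a harmless move when Bob skips
-- or plays where nothing is at risk. This is why she may not open a vase with `bc`: with a single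
-- flower ω is 3, and Bob colours the leaf edge differently, which leaves one colour for both
-- spokes. After opening with a spoke she can still colour the other one once Bob has touched the
-- vase, because at most two colours then surround it and a triangle guarantees three.

AllPairs-lookup : ∀ {A : Set} {R : A → A → Set} → Symmetric R →
  ∀ {xs} → AllPairs R xs → ∀ {i j} → i ≢ j → R (lookup xs i) (lookup xs j)
AllPairs-lookup R-sym (r ∷ rs) {zero}  {zero}  i≢j = contradiction refl i≢j
AllPairs-lookup R-sym (r ∷ rs) {zero}  {suc j} i≢j = All.lookup r (∈-lookup j)
AllPairs-lookup R-sym (r ∷ rs) {suc i} {zero}  i≢j = R-sym (All.lookup r (∈-lookup i))
AllPairs-lookup R-sym (r ∷ rs) {suc i} {suc j} i≢j = AllPairs-lookup R-sym rs (i≢j ∘ cong suc)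

-- Pigeonhole: if every colour occurred, sending it to its position in `L` would inject `Fin k` into
-- fewer than `k` positions.
∃∉ : ∀ {k} (L : List (Fin k)) → length L < k → ∃ λ a → a ∉ L
∃∉ {k} L L<k = ¬∀⟶∃¬ k (_∈ L) (_∈? L) λ all∈ →
  <⇒≱ L<k (injective⇒≤ {f = index ∘ all∈} (index-injective all∈))
  where
  open import Data.List.Membership.DecPropositional (_≟_ {k}) using (_∈?_)
  index-injective : (all∈ : ∀ a → a ∈ L) → Injective _≡_ _≡_ (index ∘ all∈)
  index-injective all∈ {a} {b} eq =
    trans (lookup-index (all∈ a)) (trans (cong (lookup L) eq) (≡-sym (lookup-index (all∈ b))))

∈-catMaybes : ∀ {A : Set} {x : A} {xs} → just x ∈ xs → x ∈ catMaybes xs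
∈-catMaybes (Any.here refl) = Any.here refl
∈-catMaybes {xs = nothing ∷ _} (Any.there x∈) = ∈-catMaybes x∈
∈-catMaybes {xs = just _ ∷ _} (Any.there x∈) = Any.there (∈-catMaybes x∈)

-- Undirected edges and their orientation

SameEdge : ∀ {m} → Fin m → Fin m → Fin m → Fin m → Set
SameEdge u v x y = (x ≡ u × y ≡ v) ⊎ (x ≡ v × y ≡ u)

sameEdge? : ∀ {m} (u v x y : Fin m) → Dec (SameEdge u v x y)
sameEdge? u v x y = (x ≟ u ×-dec y ≟ v) ⊎-dec (x ≟ v ×-dec y ≟ u)

SameEdge-flip : ∀ {m} {u v x y : Fin m} → SameEdge u v x y → SameEdge u v y x
SameEdge-flip (inj₁ (p , q)) = inj₂ (q , p)
SameEdge-flip (inj₂ (p , q)) = inj₁ (q , p)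

SameEdge-swap : ∀ {m} {u v x y : Fin m} → SameEdge u v x y → SameEdge v u x y
SameEdge-swap (inj₁ pq) = inj₂ pq
SameEdge-swap (inj₂ pq) = inj₁ pq

-- `IsEdge` wants the smaller endpoint first, whereas the proof names an edge by its role, such as a
-- spoke seen from the apex. The case of equal ends is a default that no edge reaches.
orient : ∀ {m} → Fin m → Fin m → Fin m × Fin m
orient u v with <-cmp u v
... | tri< _ _ _ = u , v
... | tri≈ _ _ _ = u , v
... | tri> _ _ _ = v , u

data Oriented {m} (u v : Fin m) : Fin m × Fin m → Set where
  kept    : Oriented u v (u , v)
  flipped : Oriented u v (v , u)

orient-view : ∀ {m} (u v : Fin m) → Oriented u v (orient u v)
orient-view u v with <-cmp u v
... | tri< _ _ _ = kept
... | tri≈ _ _ _ = kept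
... | tri> _ _ _ = flipped

shareEnd : ∀ {m} {u v x y w : Fin m} → w ≡ u ⊎ w ≡ v → w ≡ x ⊎ w ≡ y → ShareEnd (u , v) (x , y)
shareEnd (inj₁ refl) (inj₁ refl) = inj₁ refl
shareEnd (inj₁ refl) (inj₂ refl) = inj₂ (inj₁ refl)
shareEnd (inj₂ refl) (inj₁ refl) = inj₂ (inj₂ (inj₁ refl))
shareEnd (inj₂ refl) (inj₂ refl) = inj₂ (inj₂ (inj₂ refl))

orient-adjacent : ∀ {m} {u v x y w : Fin m} → w ≡ u ⊎ w ≡ v → w ≡ x ⊎ w ≡ y →
  ¬ SameEdge u v x y → DistinctAdjacent (orient u v) (orient x y)
orient-adjacent {u = u} {v} {x} {y} w∈uv w∈xy ≢e
  with orient u v | orient-view u v | orient x y | orient-view x y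
... | _ | kept | _ | kept = (λ { refl → ≢e (inj₁ (refl , refl)) }) , shareEnd w∈uv w∈xy
... | _ | kept | _ | flipped = (λ { refl → ≢e (inj₂ (refl , refl)) }) , shareEnd w∈uv (swap w∈xy)
... | _ | flipped | _ | kept = (λ { refl → ≢e (inj₂ (refl , refl)) }) , shareEnd (swap w∈uv) w∈xy
... | _ | flipped | _ | flipped = (λ { refl → ≢e (inj₁ (refl , refl)) }) , shareEnd (swap w∈uv) (swap w∈xy)

-- Stars and triangles as cliques of the line graph

module Edges (G : Graph) where

  V : Set
  V = Fin (n G)

  E : V → V → Set
  E u v = adj G u v ≡ true

  E? : ∀ u v → Dec (E u v)
  E? u v = adj G u v Bool.≟ true

  E-sym : ∀ {u v} → E u v → E v u
  E-sym {u} {v} e = trans (Graph.sym G v u) e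

  E-irr : ∀ {u} → ¬ E u u
  E-irr {u} e with trans (≡-sym e) (irr G u)
  ... | ()

  E⇒≢ : ∀ {u v} → E u v → u ≢ v
  E⇒≢ e refl = E-irr e

  orient-isEdge : ∀ {u v} → E u v → IsEdge G (orient u v)
  orient-isEdge {u} {v} e with <-cmp u v
  ... | tri< u<v _ _ = u<v , e
  ... | tri≈ _ u≡v _ = contradiction u≡v (E⇒≢ e)
  ... | tri> _ _ v<u = v<u , E-sym e

  star-isEdgeClique : ∀ {p L} → Unique L → All (E p) L → IsEdgeClique G (map (orient p) L)
  star-isEdgeClique {p} uniq es =
    All.map⁺ (All.map orient-isEdge es) ,
    AllPairs.map⁺ (AllPairs.map (λ x≢y → orient-adjacent (inj₁ refl) (inj₁ refl)
      λ { (inj₁ (_ , y≡x)) → x≢y (≡-sym y≡x)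
        ; (inj₂ (p≡x , y≡p)) → x≢y (≡-sym (trans y≡p p≡x)) }) uniq)

  triangle-isEdgeClique : ∀ {a b c} → E a b → E b c → E a c →
    IsEdgeClique G (orient a b ∷ orient a c ∷ orient b c ∷ [])
  triangle-isEdgeClique ab bc ac =
    orient-isEdge ab ∷ orient-isEdge ac ∷ orient-isEdge bc ∷ [] ,
    (orient-adjacent (inj₁ refl) (inj₁ refl)
       (λ { (inj₁ (_ , refl)) → E-irr bc ; (inj₂ (refl , _)) → E-irr ab })
     ∷ orient-adjacent (inj₂ refl) (inj₁ refl)
       (λ { (inj₁ (refl , _)) → E-irr ab ; (inj₂ (_ , refl)) → E-irr ac }) ∷ [])
    ∷ (orient-adjacent (inj₂ refl) (inj₂ refl)
       (λ { (inj₁ (refl , _)) → E-irr ab ; (inj₂ (refl , _)) → E-irr bc }) ∷ [])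
    ∷ [] ∷ []

-- Proper partial colourings, legal moves and free colours

module Colouring (G : Graph) (k : ℕ) where

  open Edges G

  -- `Col` is an arbitrary matrix of optional colours; these invariants hold for every matrix that
  -- arises in play. `inj` is the colouring condition read at one vertex: a colour determines the
  -- edge.
  record Proper (c : Col G k) : Set where
    field
      symm   : ∀ x y → c x y ≡ c y x
      onEdge : ∀ {x y a} → c x y ≡ just a → E x y
      inj    : ∀ {x y z a} → c x y ≡ just a → c x z ≡ just a → y ≡ z
  open Proper public

  empty-proper : Proper (empty G k)
  empty-proper = record { symm = λ _ _ → refl ; onEdge = λ () ; inj = λ () }

  _⊑_ : Col G k → Col G k → Set
  c ⊑ c′ = ∀ {x y a} → c x y ≡ just a → c′ x y ≡ just a

  Free : Col G k → V → Fin k → Set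
  Free c u a = ∀ w → c u w ≢ just a

  -- `Move` insists on `u < v`, and `play` computes with Boolean tests. This relation hides both: on
  -- proper colourings it is symmetric in the two ends, and it describes the new colouring by its
  -- values.
  record Step (c : Col G k) (u v : V) (a : Fin k) (c′ : Col G k) : Set where
    field
      edge  : E u v
      fresh : c u v ≡ nothing
      freeˡ : Free c u a
      freeʳ : Free c v a
      on    : ∀ {x y} → SameEdge u v x y → c′ x y ≡ just a
      off   : ∀ {x y} → ¬ SameEdge u v x y → c′ x y ≡ c x y
  open Step public

  just≢nothing : ∀ {c : Col G k} {x y a} → c x y ≡ just a → c x y ≢ nothing
  just≢nothing p q with trans (≡-sym p) q
  ... | ()

  play-step : ∀ {c} (m : Move G k c) → Step c (Move.u m) (Move.v m) (Move.a m) (play c m)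
  play-step {c} m@(move u v u<v e f a okU okV) = record
    { edge = e ; fresh = f ; freeˡ = okU ; freeʳ = okV ; on = on′ ; off = off′ }
    where
    on′ : ∀ {x y} → SameEdge u v x y → play c m x y ≡ just a
    on′ {x} {y} s with x ≟ u | y ≟ v | x ≟ v | y ≟ u
    ... | yes _ | yes _ | _ | _ = refl
    ... | no _ | _ | yes _ | yes _ = refl
    ... | yes _ | no _ | yes _ | yes _ = refl
    ... | no x≢u | _ | no x≢v | _ = contradiction s λ { (inj₁ (p , _)) → x≢u p ; (inj₂ (p , _)) → x≢v p }
    ... | no x≢u | _ | yes _ | no y≢u = contradiction s λ { (inj₁ (p , _)) → x≢u p ; (inj₂ (_ , p)) → y≢u p }
    ... | yes _ | no y≢v | no x≢v | _ = contradiction s λ { (inj₁ (_ , p)) → y≢v p ; (inj₂ (p , _)) → x≢v p }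
    ... | yes _ | no y≢v | yes _ | no y≢u = contradiction s λ { (inj₁ (_ , p)) → y≢v p ; (inj₂ (_ , p)) → y≢u p }
    off′ : ∀ {x y} → ¬ SameEdge u v x y → play c m x y ≡ c x y
    off′ {x} {y} ¬s with x ≟ u | y ≟ v | x ≟ v | y ≟ u
    ... | yes p | yes q | _ | _ = contradiction (inj₁ (p , q)) ¬s
    ... | no _ | _ | yes p | yes q = contradiction (inj₂ (p , q)) ¬s
    ... | yes _ | no _ | yes p | yes q = contradiction (inj₂ (p , q)) ¬s
    ... | no _ | _ | no _ | _ = refl
    ... | no _ | _ | yes _ | no _ = refl
    ... | yes _ | no _ | no _ | _ = refl
    ... | yes _ | no _ | yes _ | no _ = refl

  step-swap : ∀ {c u v a c′} → Proper c → Step c u v a c′ → Step c v u a c′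
  step-swap {c} {u} {v} pc s = record
    { edge = E-sym (edge s) ; fresh = trans (symm pc v u) (fresh s)
    ; freeˡ = freeʳ s ; freeʳ = freeˡ s
    ; on = on s ∘ SameEdge-swap ; off = λ ¬s → off s (¬s ∘ SameEdge-swap) }

  step-⊑ : ∀ {c u v a c′} → Proper c → Step c u v a c′ → c ⊑ c′
  step-⊑ {c} {u} {v} pc s {x} {y} p with sameEdge? u v x y
  ... | no ¬e = trans (off s ¬e) p
  ... | yes (inj₁ (refl , refl)) = contradiction (fresh s) (just≢nothing {c} p)
  ... | yes (inj₂ (refl , refl)) = contradiction (trans (symm pc v u) (fresh s)) (just≢nothing {c} p)

  step-cases : ∀ {c u v a c′} → Step c u v a c′ → ∀ {x y b} → c′ x y ≡ just b →
    (SameEdge u v x y × b ≡ a) ⊎ (c x y ≡ just b)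
  step-cases {u = u} {v} s {x} {y} p with sameEdge? u v x y
  ... | no ¬e = inj₂ (trans (≡-sym (off s ¬e)) p)
  ... | yes e = inj₁ (e , just-injective (trans (≡-sym p) (on s e)))

  step-proper : ∀ {c u v a c′} → Proper c → Step c u v a c′ → Proper c′
  step-proper {c} {u} {v} {a} {c′} pc s = record { symm = symm′ ; onEdge = onEdge′ ; inj = inj′ }
    where
    symm′ : ∀ x y → c′ x y ≡ c′ y x
    symm′ x y with sameEdge? u v x y
    ... | yes e = trans (on s e) (≡-sym (on s (SameEdge-flip e)))
    ... | no ¬e = trans (off s ¬e) (trans (symm pc x y) (≡-sym (off s (¬e ∘ SameEdge-flip))))
    onEdge′ : ∀ {x y b} → c′ x y ≡ just b → E x y
    onEdge′ p with step-cases s p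
    ... | inj₁ (inj₁ (refl , refl) , _) = edge s
    ... | inj₁ (inj₂ (refl , refl) , _) = E-sym (edge s)
    ... | inj₂ q = onEdge pc q
    free-at : ∀ {x y} → SameEdge u v x y → Free c x a
    free-at (inj₁ (refl , _)) = freeˡ s
    free-at (inj₂ (refl , _)) = freeʳ s
    inj′ : ∀ {x y z b} → c′ x y ≡ just b → c′ x z ≡ just b → y ≡ z
    inj′ p q with step-cases s p | step-cases s q
    ... | inj₂ p′ | inj₂ q′ = inj pc p′ q′
    ... | inj₁ (e , refl) | inj₂ q′ = contradiction q′ (free-at e _)
    ... | inj₂ p′ | inj₁ (e , refl) = contradiction p′ (free-at e _)
    ... | inj₁ (inj₁ (refl , refl) , _) | inj₁ (inj₁ (_ , refl) , _) = refl
    ... | inj₁ (inj₂ (refl , refl) , _) | inj₁ (inj₂ (_ , refl) , _) = refl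
    ... | inj₁ (inj₁ (refl , refl) , _) | inj₁ (inj₂ (refl , _) , _) = contradiction (edge s) E-irr
    ... | inj₁ (inj₂ (refl , refl) , _) | inj₁ (inj₁ (refl , _) , _) = contradiction (edge s) E-irr

  makeStep : ∀ {c u v a} → Proper c → E u v → c u v ≡ nothing → Free c u a → Free c v a →
    ∃ λ m → Step c u v a (play c m)
  makeStep {c} {u} {v} {a} pc e f okU okV with <-cmp u v
  ... | tri< u<v _ _ = let m = move u v u<v e f a okU okV in m , play-step m
  ... | tri≈ _ u≡v _ = contradiction u≡v (E⇒≢ e)
  ... | tri> _ _ v<u =
    let m = move v u v<u (E-sym e) (trans (symm pc v u) f) a okV okU in m , step-swap pc (play-step m)

  -- Follows a single line of play, in which Bob always makes the move exhibited by `bTurn`. The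
  -- complete colouring at its end serves twice: it bounds the clique number, and it refutes a win
  -- from a position that Bob has spoiled.
  outcome : ∀ {Y p c} → Wins G k Y p c → Proper c →
    ∃ λ c′ → Proper c′ × AllColoured {G} c′ × c ⊑ c′
  outcome {c = c} (finished all) pc = c , pc , all , id
  outcome (aSkip _ w) pc = outcome w pc
  outcome {c = c} (aMove m w) pc
    with c′ , pc′ , all , le ← outcome w (step-proper pc (play-step m)) =
    c′ , pc′ , all , le ∘ step-⊑ pc (play-step m)
  outcome {c = c} (bTurn m w _) pc
    with c′ , pc′ , all , le ← outcome (w m) (step-proper pc (play-step m)) =
    c′ , pc′ , all , le ∘ step-⊑ pc (play-step m)

  clique≤colours : ∀ {c} → Proper c → AllColoured {G} c → ∀ {es} → IsEdgeClique G es → length es ≤ k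
  clique≤colours {c} pc all {es} (edges , pairs) = injective⇒≤ {f = colour} colour-injective
    where
    isEdge : ∀ i → IsEdge G (lookup es i)
    isEdge i = All.lookup edges (∈-lookup i)
    coloured : ∀ i → ∃ λ a → c (proj₁ (lookup es i)) (proj₂ (lookup es i)) ≡ just a
    coloured i = all _ _ (proj₂ (isEdge i))
    colour : Fin (length es) → Fin k
    colour = proj₁ ∘ coloured
    DA-sym : ∀ {m} → Symmetric (DistinctAdjacent {m})
    DA-sym (e≢f , s) = e≢f ∘ ≡-sym , flip s
      where
      flip : ∀ {m} {u v x y : Fin m} → ShareEnd (u , v) (x , y) → ShareEnd (x , y) (u , v)
      flip (inj₁ p) = inj₁ (≡-sym p)
      flip (inj₂ (inj₁ p)) = inj₂ (inj₂ (inj₁ (≡-sym p)))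
      flip (inj₂ (inj₂ (inj₁ p))) = inj₂ (inj₁ (≡-sym p))
      flip (inj₂ (inj₂ (inj₂ p))) = inj₂ (inj₂ (inj₂ (≡-sym p)))
    -- Equal colours at a common end force one and the same edge, so the ordered pairs are equal or
    -- reversed. `e≢f` excludes the first, increasing endpoints the second.
    differ : ∀ {u v x y a} → DistinctAdjacent (u , v) (x , y) →
      c u v ≡ just a → c x y ≡ just a → ¬ ((u , v) ≢ (y , x))
    differ (e≢f , inj₁ refl) p q _ = e≢f (cong (_ ,_) (inj pc p q))
    differ (e≢f , inj₂ (inj₁ refl)) p q ≢ = ≢ (cong (_ ,_) (inj pc p (trans (symm pc _ _) q)))
    differ {v = v} (e≢f , inj₂ (inj₂ (inj₁ refl))) p q ≢ =
      ≢ (cong (_, v) (inj pc (trans (symm pc _ _) p) q))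
    differ {v = v} (e≢f , inj₂ (inj₂ (inj₂ refl))) p q _ =
      e≢f (cong (_, v) (inj pc (trans (symm pc _ _) p) (trans (symm pc _ _) q)))
    not-flipped : ∀ {m} {u v x y : Fin m} → u F.< v → x F.< y → (u , v) ≢ (y , x)
    not-flipped u<v x<y refl = <-asym u<v x<y
    colour-injective : Injective _≡_ _≡_ colour
    colour-injective {i} {j} eq with i ≟ j
    ... | yes i≡j = i≡j
    ... | no i≢j = contradiction
      (not-flipped (proj₁ (isEdge i)) (proj₁ (isEdge j)))
      (differ (AllPairs-lookup DA-sym pairs i≢j)
        (proj₂ (coloured i)) (trans (proj₂ (coloured j)) (cong just (≡-sym eq))))

  module _ (ω≤k : ∀ es → IsEdgeClique G es → length es ≤ k) where

    star≤ : ∀ {p} L → Unique L → All (E p) L → length L ≤ k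
    star≤ {p} L uniq es = ≤-trans (≤-reflexive (≡-sym (length-map (orient p) L)))
      (ω≤k _ (star-isEdgeClique uniq es))

    triangle≤ : ∀ {a b c} → E a b → E b c → E a c → 3 ≤ k
    triangle≤ ab bc ac = ω≤k _ (triangle-isEdgeClique ab bc ac)

    -- An uncoloured edge leaves at most deg u − 1 < k colours in use at u.
    ∃Free : ∀ {c u v} → Proper c → E u v → c u v ≡ nothing → ∃ (Free c u)
    ∃Free {c} {u} {v} pc e f
      with any? (λ a → all? (λ w → ¬? (Maybe-≡-dec _≟_ (c u w) (just a))))
    ... | yes free = free
    ... | no ¬free = contradiction
      (≤-trans (≤-reflexive (cong suc (≡-sym (trans (length-map nbr (allFin k)) (length-tabulate id)))))
               (star≤ (v ∷ map nbr (allFin k)) unique adjacent))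
      1+n≰n
      where
      used : ∀ a → ∃ λ w → c u w ≡ just a
      used a with any? (λ w → Maybe-≡-dec _≟_ (c u w) (just a))
      ... | yes p = p
      ... | no ¬p = contradiction (a , λ w p → ¬p (w , p)) ¬free
      nbr : Fin k → V
      nbr = proj₁ ∘ used
      unique : Unique (v ∷ map nbr (allFin k))
      unique = All.map⁺ (All.universal (λ a v≡ → just≢nothing {c} (proj₂ (used a))
                 (trans (cong (c u) (≡-sym v≡)) f)) _)
             ∷ Unique.map⁺ (λ {a} {b} eq → just-injective (trans (≡-sym (proj₂ (used a)))
                 (trans (cong (c u) eq) (proj₂ (used b))))) (Unique.allFin⁺ k)
      adjacent : All (E u) (v ∷ map nbr (allFin k))
      adjacent = e ∷ All.map⁺ (All.universal (λ a → onEdge pc (proj₂ (used a))) _)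

    -- When each colour seen at `v` is also seen at `u`, the degree bound at `u` alone leaves a
    -- colour. This covers leaf edges, and spokes whose base edge has a colour that recurs at the
    -- apex.
    starStep : ∀ {c u v} → Proper c → E u v → c u v ≡ nothing →
      (∀ {w a} → c v w ≡ just a → ∃ λ x → c u x ≡ just a) →
      ∃ λ a → ∃ λ m → Step c u v a (play c m)
    starStep pc e f v⊆u with a , free ← ∃Free pc e f =
      a , makeStep pc e f free (λ w p → free _ (proj₂ (v⊆u p)))

    -- For edges with few coloured neighbours. `used` holds optional colours, so that entries of `c`
    -- can be listed without knowing whether they are coloured; discarding the blanks only shortens
    -- the list.
    listStep : ∀ {c u v} → Proper c → E u v → c u v ≡ nothing →
      ∀ used → length used < k →
      (∀ {w a} → c u w ≡ just a → just a ∈ used) → (∀ {w a} → c v w ≡ just a → just a ∈ used) →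
      ∃ λ a → ∃ λ m → Step c u v a (play c m)
    listStep pc e f used used<k u⊆ v⊆
      with a , a∉ ← ∃∉ (catMaybes used) (≤-<-trans (length-catMaybes used) used<k) =
      a , makeStep pc e f (λ w → a∉ ∘ ∈-catMaybes ∘ u⊆) (λ w → a∉ ∘ ∈-catMaybes ∘ v⊆)

-- Structure of the components

lookup-injective : ∀ {A : Set} {xs : List A} → Unique xs → Injective _≡_ _≡_ (lookup xs)
lookup-injective uniq {i} {j} eq with i ≟ j
... | yes i≡j = i≡j
... | no i≢j = contradiction eq (AllPairs-lookup (_∘ ≡-sym) uniq i≢j)

module Components (G : Graph) where

  open Edges G public

  reach-trans : ∀ {u v w} → Reach G u v → Reach G v w → Reach G u w
  reach-trans r here = r
  reach-trans r (step s e) = step (reach-trans r s) e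

  reach-sym : ∀ {u v} → Reach G u v → Reach G v u
  reach-sym here = here
  reach-sym (step r e) = reach-trans (step here (E-sym e)) (reach-sym r)

  Pendant : V → V → Set
  Pendant p x = ∀ {y} → E x y → y ≡ p

  record IsDoubleStar (p q : V) : Set where
    field
      pq : E p q
      Np : ∀ {x} → E p x → x ≡ q ⊎ Pendant p x
      Nq : ∀ {x} → E q x → x ≡ p ⊎ Pendant q x

  record IsVase (a b c : V) : Set where
    field
      ab : E a b
      ac : E a c
      bc : E b c
      Na : ∀ {x} → E a x → x ≡ b ⊎ x ≡ c ⊎ Pendant a x
      Nb : ∀ {x} → E b x → x ≡ a ⊎ x ≡ c
      Nc : ∀ {x} → E c x → x ≡ a ⊎ x ≡ b

  data Block : Set where
    dstar : (p q : V) → Block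
    vase  : (a b c : V) → Block

  IsBlock : Block → Set
  IsBlock (dstar p q)  = IsDoubleStar p q
  IsBlock (vase a b c) = IsVase a b c

  infix 4 _∈ᵇ_
  -- The two centres of a double star are neighbours of each other, so neighbourhoods already
  -- contain them; only the apex of a vase has to be added by hand.
  _∈ᵇ_ : V → Block → Set
  x ∈ᵇ dstar p q  = E p x ⊎ E q x
  x ∈ᵇ vase a b c = x ≡ a ⊎ E a x

  _∈ᵇ?_ : ∀ x γ → Dec (x ∈ᵇ γ)
  x ∈ᵇ? dstar p q  = E? p x ⊎-dec E? q x
  x ∈ᵇ? vase a b c = (x ≟ a) ⊎-dec E? a x

  closed : ∀ γ → IsBlock γ → ∀ {x y} → x ∈ᵇ γ → E x y → y ∈ᵇ γ
  closed (dstar p q) is (inj₁ px) xy with IsDoubleStar.Np is px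
  ... | inj₁ refl = inj₂ xy
  ... | inj₂ pend rewrite pend xy = inj₂ (E-sym (IsDoubleStar.pq is))
  closed (dstar p q) is (inj₂ qx) xy with IsDoubleStar.Nq is qx
  ... | inj₁ refl = inj₁ xy
  ... | inj₂ pend rewrite pend xy = inj₁ (IsDoubleStar.pq is)
  closed (vase a b c) is (inj₁ refl) xy = inj₂ xy
  closed (vase a b c) is (inj₂ ax) xy with IsVase.Na is ax
  ... | inj₂ (inj₂ pend) = inj₁ (pend xy)
  ... | inj₁ refl with IsVase.Nb is xy
  ...   | inj₁ y≡a = inj₁ y≡a
  ...   | inj₂ refl = inj₂ (IsVase.ac is)
  closed (vase a b c) is (inj₂ ax) xy | inj₂ (inj₁ refl) with IsVase.Nc is xy
  ...   | inj₁ y≡a = inj₁ y≡a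
  ...   | inj₂ refl = inj₂ (IsVase.ab is)

  closed-reach : ∀ γ → IsBlock γ → ∀ {x y} → x ∈ᵇ γ → Reach G x y → y ∈ᵇ γ
  closed-reach γ is x∈ here = x∈
  closed-reach γ is x∈ (step r e) = closed γ is (closed-reach γ is x∈ r) e

  connected : ∀ γ → IsBlock γ → ∀ {x y} → x ∈ᵇ γ → y ∈ᵇ γ → Reach G x y
  connected γ is x∈ y∈ = reach-trans (reach-sym (from-hub γ is x∈)) (from-hub γ is y∈)
    where
    hub : Block → V
    hub (dstar p q)  = p
    hub (vase a b c) = a
    from-hub : ∀ γ → IsBlock γ → ∀ {x} → x ∈ᵇ γ → Reach G (hub γ) x
    from-hub (dstar p q) is (inj₁ px) = step here px
    from-hub (dstar p q) is (inj₂ qx) = step (step here (IsDoubleStar.pq is)) qx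
    from-hub (vase a b c) is (inj₁ refl) = here
    from-hub (vase a b c) is (inj₂ ax) = step here ax

  -- The meeting point of conditions (4) and (5), and all that the strategy knows of the graph.
  -- Isolated vertices carry no edge and so need no block.
  Blocks : Set
  Blocks = ∀ {u v} → E u v → ∃ λ γ → IsBlock γ × u ∈ᵇ γ

  Extra : V → V → V → V → Set
  Extra a b c x = E a x × x ≢ b × x ≢ c

  Extra-swap : ∀ {a b c} → ∃ (Extra a b c) → ∃ (Extra a c b)
  Extra-swap (x , e , x≢b , x≢c) = x , e , x≢c , x≢b

  extra? : ∀ a b c → Dec (∃ (Extra a b c))
  extra? a b c = any? λ x → E? a x ×-dec (¬? (x ≟ b) ×-dec ¬? (x ≟ c))

  ¬extra⇒N : ∀ {a b c} → ¬ ∃ (Extra a b c) → ∀ {x} → E a x → x ≡ b ⊎ x ≡ c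
  ¬extra⇒N {a} {b} {c} none {x} ax with x ≟ b | x ≟ c
  ... | yes p | _ = inj₁ p
  ... | _ | yes q = inj₂ q
  ... | no p | no q = contradiction (x , ax , p , q) none

  -- From forbidden subgraphs to blocks

  module _ (noP5 : ¬ EdgeInducedSub (P 5) G) (noC4 : ¬ EdgeInducedSub C4 G) where

    ¬path : ∀ {x₀ x₁ x₂ x₃ x₄} → E x₀ x₁ → E x₁ x₂ → E x₂ x₃ → E x₃ x₄ →
      x₀ ≢ x₂ → x₀ ≢ x₃ → x₀ ≢ x₄ → x₁ ≢ x₃ → x₁ ≢ x₄ → x₂ ≢ x₄ → ⊥
    ¬path {x₀} {x₁} {x₂} {x₃} {x₄} e₀ e₁ e₂ e₃ ≢₀₂ ≢₀₃ ≢₀₄ ≢₁₃ ≢₁₄ ≢₂₄ =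
      noP5 (lookup (x₀ ∷ x₁ ∷ x₂ ∷ x₃ ∷ x₄ ∷ []) , lookup-injective unique , hom , nonisolated)
      where
      unique : Unique (x₀ ∷ x₁ ∷ x₂ ∷ x₃ ∷ x₄ ∷ [])
      unique = (E⇒≢ e₀ ∷ ≢₀₂ ∷ ≢₀₃ ∷ ≢₀₄ ∷ []) ∷ (E⇒≢ e₁ ∷ ≢₁₃ ∷ ≢₁₄ ∷ []) ∷ (E⇒≢ e₂ ∷ ≢₂₄ ∷ [])
             ∷ (E⇒≢ e₃ ∷ []) ∷ [] ∷ []
      hom : ∀ i j → adj (P 5) i j ≡ true → E (lookup (x₀ ∷ x₁ ∷ x₂ ∷ x₃ ∷ x₄ ∷ []) i) (lookup (x₀ ∷ x₁ ∷ x₂ ∷ x₃ ∷ x₄ ∷ []) j)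
      hom zero (suc zero) refl = e₀
      hom (suc zero) zero refl = E-sym e₀
      hom (suc zero) (suc (suc zero)) refl = e₁
      hom (suc (suc zero)) (suc zero) refl = E-sym e₁
      hom (suc (suc zero)) (suc (suc (suc zero))) refl = e₂
      hom (suc (suc (suc zero))) (suc (suc zero)) refl = E-sym e₂
      hom (suc (suc (suc zero))) (suc (suc (suc (suc zero)))) refl = e₃
      hom (suc (suc (suc (suc zero)))) (suc (suc (suc zero))) refl = E-sym e₃
      hom (suc (suc (suc (suc zero)))) (suc (suc (suc (suc zero)))) ()
      nonisolated : ∀ i → ∃ λ j → adj (P 5) i j ≡ true
      nonisolated zero = suc zero , refl
      nonisolated (suc zero) = zero , refl
      nonisolated (suc (suc zero)) = suc zero , refl
      nonisolated (suc (suc (suc zero))) = suc (suc zero) , refl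
      nonisolated (suc (suc (suc (suc zero)))) = suc (suc (suc zero)) , refl

    ¬square : ∀ {x₀ x₁ x₂ x₃} → E x₀ x₁ → E x₁ x₂ → E x₂ x₃ → E x₃ x₀ → x₀ ≢ x₂ → x₁ ≢ x₃ → ⊥
    ¬square {x₀} {x₁} {x₂} {x₃} e₀ e₁ e₂ e₃ ≢₀₂ ≢₁₃ =
      noC4 (lookup (x₀ ∷ x₁ ∷ x₂ ∷ x₃ ∷ []) , lookup-injective unique , hom , nonisolated)
      where
      unique : Unique (x₀ ∷ x₁ ∷ x₂ ∷ x₃ ∷ [])
      unique = (E⇒≢ e₀ ∷ ≢₀₂ ∷ E⇒≢ (E-sym e₃) ∷ []) ∷ (E⇒≢ e₁ ∷ ≢₁₃ ∷ []) ∷ (E⇒≢ e₂ ∷ []) ∷ [] ∷ []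
      hom : ∀ i j → adj C4 i j ≡ true → E (lookup (x₀ ∷ x₁ ∷ x₂ ∷ x₃ ∷ []) i) (lookup (x₀ ∷ x₁ ∷ x₂ ∷ x₃ ∷ []) j)
      hom zero (suc zero) refl = e₀
      hom (suc zero) zero refl = E-sym e₀
      hom (suc zero) (suc (suc zero)) refl = e₁
      hom (suc (suc zero)) (suc zero) refl = E-sym e₁
      hom (suc (suc zero)) (suc (suc (suc zero))) refl = e₂
      hom (suc (suc (suc zero))) (suc (suc zero)) refl = E-sym e₂
      hom (suc (suc (suc zero))) zero refl = e₃
      hom zero (suc (suc (suc zero))) refl = E-sym e₃
      nonisolated : ∀ i → ∃ λ j → adj C4 i j ≡ true
      nonisolated zero = suc zero , refl
      nonisolated (suc zero) = zero , refl
      nonisolated (suc (suc zero)) = suc zero , refl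
      nonisolated (suc (suc (suc zero))) = suc (suc zero) , refl

    -- Go from `a` to `b` the long way, through `c`: further neighbours `x` of `a` and `y` of `b`
    -- close this to the 4-cycle `x a c b` if they coincide, and extend it to the path `x a c b y`
    -- otherwise.
    ¬two-extras : ∀ {a b c} → E a b → E a c → E b c → ∃ (Extra a b c) → ¬ ∃ (Extra b a c)
    ¬two-extras ab ac bc (x , ax , x≢b , x≢c) (y , by , y≢a , y≢c) with x ≟ y
    ... | yes refl = ¬square (E-sym ax) ac (E-sym bc) by x≢c (E⇒≢ ab)
    ... | no x≢y = ¬path (E-sym ax) ac (E-sym bc) by x≢c x≢b x≢y (E⇒≢ ab) (y≢a ∘ ≡-sym) (y≢c ∘ ≡-sym)

    -- A further neighbour `x` of `a` is pendant: a second neighbour `y` of `x` is not `b` or `c`,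
    -- which have no extras, and otherwise `y x a b c` is a five-vertex path.
    triangle⇒IsVase : ∀ {a b c} → E a b → E a c → E b c →
      ¬ ∃ (Extra b a c) → ¬ ∃ (Extra c a b) → IsVase a b c
    triangle⇒IsVase {a} {b} {c} ab ac bc ¬b ¬c = record
      { ab = ab ; ac = ac ; bc = bc ; Na = Na ; Nb = Nb ; Nc = Nc }
      where
      Nb = ¬extra⇒N ¬b
      Nc = ¬extra⇒N ¬c
      Na : ∀ {x} → E a x → x ≡ b ⊎ x ≡ c ⊎ Pendant a x
      Na {x} ax with x ≟ b | x ≟ c
      ... | yes p | _ = inj₁ p
      ... | no _ | yes q = inj₂ (inj₁ q)
      ... | no x≢b | no x≢c = inj₂ (inj₂ pendant)
        where
        pendant : Pendant a x
        pendant {y} xy with y ≟ a | y ≟ b | y ≟ c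
        ... | yes p | _ | _ = p
        ... | no y≢a | yes refl | _ = contradiction (x , E-sym xy , E⇒≢ (E-sym ax) , x≢c) ¬b
        ... | no y≢a | _ | yes refl = contradiction (x , E-sym xy , E⇒≢ (E-sym ax) , x≢b) ¬c
        ... | no y≢a | no y≢b | no y≢c =
          ⊥-elim (¬path (E-sym xy) (E-sym ax) ab bc y≢a y≢b y≢c x≢b x≢c (E⇒≢ ac))

    -- The apex has to be the vertex with further neighbours, which is unique by `¬two-extras`; if
    -- there is none, any vertex serves.
    triangle⇒Block : ∀ {a b c} → E a b → E a c → E b c → ∃ λ γ → IsBlock γ × a ∈ᵇ γ
    triangle⇒Block {a} {b} {c} ab ac bc with extra? b a c | extra? c a b
    ... | yes b⁺ | _ = vase b a c ,
      triangle⇒IsVase ba bc ac (¬two-extras ba bc ac b⁺) (¬two-extras bc ba (E-sym ac) (Extra-swap b⁺))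
      , inj₂ ba
      where
      ba = E-sym ab
    ... | no ¬b | yes c⁺ = vase c a b ,
      triangle⇒IsVase ca cb ab (¬two-extras ca cb ab c⁺) (¬b ∘ Extra-swap)
      , inj₂ ca
      where
      ca = E-sym ac
      cb = E-sym bc
    ... | no ¬b | no ¬c = vase a b c , triangle⇒IsVase ab ac bc ¬b ¬c , inj₁ refl

    NonPendant : V → V → Set
    NonPendant p x = ∃ λ y → E x y × y ≢ p

    nonPendant? : ∀ p x → Dec (NonPendant p x)
    nonPendant? p x = any? λ y → E? x y ×-dec ¬? (y ≟ p)

    ¬nonPendant : ∀ {p x} → ¬ NonPendant p x → Pendant p x
    ¬nonPendant {p} none {y} xy with y ≟ p
    ... | yes y≡p = y≡p
    ... | no y≢p = contradiction (y , xy , y≢p) none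

    -- Let `z` be a second neighbour of `q`, and let `y` be a second neighbour of some `x` adjacent
    -- to `p`. Then `y = z` gives the 4-cycle `p x z q`, `y = q` a triangle on `pq`, and any other
    -- `y` the path `y x p q z`.
    no-triangle⇒N : ∀ {p q} → E p q → ¬ (∃ λ z → E p z × E q z) → NonPendant p q →
      ∀ {x} → E p x → x ≡ q ⊎ Pendant p x
    no-triangle⇒N {p} {q} pq ¬z (z , qz , z≢p) {x} px with x ≟ q
    ... | yes x≡q = inj₁ x≡q
    ... | no x≢q = inj₂ pendant
      where
      x≢z : x ≢ z
      x≢z refl = ¬z (z , px , qz)
      pendant : Pendant p x
      pendant {y} xy with y ≟ p | y ≟ z | y ≟ q
      ... | yes y≡p | _ | _ = y≡p
      ... | no y≢p | yes refl | _ = ⊥-elim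
        (¬square px xy (E-sym qz) (E-sym pq) (z≢p ∘ ≡-sym) x≢q)
      ... | no y≢p | no y≢z | yes refl = contradiction (x , px , E-sym xy) ¬z
      ... | no y≢p | no y≢z | no y≢q = ⊥-elim
        (¬path (E-sym xy) (E-sym px) pq qz y≢p y≢q y≢z x≢q x≢z (z≢p ∘ ≡-sym))

    inner⇒Block : ∀ {p q} → E p q → NonPendant p q → NonPendant q p → ∃ λ γ → IsBlock γ × p ∈ᵇ γ
    inner⇒Block {p} {q} pq np nq with any? (λ z → E? p z ×-dec E? q z)
    ... | yes (z , pz , qz) = triangle⇒Block pq pz qz
    ... | no ¬z = dstar p q ,
      record { pq = pq ; Np = no-triangle⇒N pq ¬z np
             ; Nq = no-triangle⇒N (E-sym pq) (λ { (z , qz , pz) → ¬z (z , pz , qz) }) nq }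
      , inj₂ (E-sym pq)

    -- A pendant edge does not reveal its component. A non-pendant neighbour `x` of `p` makes `px`
    -- an edge with two non-pendant ends, because `q` is a second neighbour of `p`; without such an
    -- `x` the component is a star around `p`.
    pendant⇒Block : ∀ {p q} → E p q → Pendant p q → ∃ λ γ → IsBlock γ × p ∈ᵇ γ
    pendant⇒Block {p} {q} pq pend with any? (λ x → E? p x ×-dec nonPendant? p x)
    ... | no none = dstar p q ,
      record { pq = pq ; Np = λ px → inj₂ (¬nonPendant (λ np → none (_ , px , np)))
             ; Nq = inj₁ ∘ pend }
      , inj₂ (E-sym pq)
    ... | yes (x , px , y , xy , y≢p) = inner⇒Block px (y , xy , y≢p) (q , pq , q≢x)
      where
      q≢x : q ≢ x
      q≢x refl = y≢p (pend xy)

    ¬P5¬C4⇒Blocks : Blocks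
    ¬P5¬C4⇒Blocks {u} {v} uv with nonPendant? u v | nonPendant? v u
    ... | yes nv | yes nu = inner⇒Block uv nv nu
    ... | no ¬nv | _ = pendant⇒Block uv (¬nonPendant ¬nv)
    ... | yes _ | no ¬nu with γ , is , v∈ ← pendant⇒Block (E-sym uv) (¬nonPendant ¬nu) =
      γ , is , closed γ is v∈ (E-sym uv)

  -- Blocks contain neither a five-vertex path nor a 4-cycle

  module _ (blocks : Blocks) where

    -- Every vertex of the block with at least two neighbours is among these. Inner vertices of a
    -- path and all vertices of a cycle must therefore be found here.
    Core : Block → V → Set
    Core (dstar p q)  x = x ≡ p ⊎ x ≡ q
    Core (vase a b c) x = x ≡ a ⊎ x ≡ b ⊎ x ≡ c

    core : ∀ γ → IsBlock γ → ∀ {x y z} → x ∈ᵇ γ → E x y → E x z → y ≢ z → Core γ x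
    core (dstar p q) is (inj₁ px) xy xz y≢z with IsDoubleStar.Np is px
    ... | inj₁ x≡q = inj₂ x≡q
    ... | inj₂ pend = contradiction (trans (pend xy) (≡-sym (pend xz))) y≢z
    core (dstar p q) is (inj₂ qx) xy xz y≢z with IsDoubleStar.Nq is qx
    ... | inj₁ x≡p = inj₁ x≡p
    ... | inj₂ pend = contradiction (trans (pend xy) (≡-sym (pend xz))) y≢z
    core (vase a b c) is (inj₁ x≡a) xy xz y≢z = inj₁ x≡a
    core (vase a b c) is (inj₂ ax) xy xz y≢z with IsVase.Na is ax
    ... | inj₁ x≡b = inj₂ (inj₁ x≡b)
    ... | inj₂ (inj₁ x≡c) = inj₂ (inj₂ x≡c)
    ... | inj₂ (inj₂ pend) = contradiction (trans (pend xy) (≡-sym (pend xz))) y≢z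

    ¬3-dstar : ∀ {p q x y z : V} → x ≡ p ⊎ x ≡ q → y ≡ p ⊎ y ≡ q → z ≡ p ⊎ z ≡ q →
      x ≢ y → x ≢ z → y ≢ z → ⊥
    ¬3-dstar (inj₁ refl) (inj₁ refl) _ x≢y _ _ = x≢y refl
    ¬3-dstar (inj₂ refl) (inj₂ refl) _ x≢y _ _ = x≢y refl
    ¬3-dstar (inj₁ refl) (inj₂ refl) (inj₁ refl) _ x≢z _ = x≢z refl
    ¬3-dstar (inj₁ refl) (inj₂ refl) (inj₂ refl) _ _ y≢z = y≢z refl
    ¬3-dstar (inj₂ refl) (inj₁ refl) (inj₁ refl) _ _ y≢z = y≢z refl
    ¬3-dstar (inj₂ refl) (inj₁ refl) (inj₂ refl) _ x≢z _ = x≢z refl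

    -- A base vertex `x` has just the two other triangle vertices as neighbours, so `x`, `y`, `z`
    -- exhaust the core and leave no room for `w`.
    ¬base : ∀ {a b c x y z w} → IsVase a b c → x ≡ b ⊎ x ≡ c → E x y → E x z → y ≢ z →
      Core (vase a b c) w → w ≢ x → w ≢ y → w ≢ z → ⊥
    ¬base is (inj₁ refl) xy xz y≢z w w≢x w≢y w≢z
      with IsVase.Nb is xy | IsVase.Nb is xz | w
    ... | inj₁ refl | inj₁ refl | _ = y≢z refl
    ... | inj₂ refl | inj₂ refl | _ = y≢z refl
    ... | _ | _ | inj₂ (inj₁ refl) = w≢x refl
    ... | inj₁ refl | inj₂ refl | inj₁ refl = w≢y refl
    ... | inj₁ refl | inj₂ refl | inj₂ (inj₂ refl) = w≢z refl
    ... | inj₂ refl | inj₁ refl | inj₁ refl = w≢z refl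
    ... | inj₂ refl | inj₁ refl | inj₂ (inj₂ refl) = w≢y refl
    ¬base is (inj₂ refl) xy xz y≢z w w≢x w≢y w≢z
      with IsVase.Nc is xy | IsVase.Nc is xz | w
    ... | inj₁ refl | inj₁ refl | _ = y≢z refl
    ... | inj₂ refl | inj₂ refl | _ = y≢z refl
    ... | _ | _ | inj₂ (inj₂ refl) = w≢x refl
    ... | inj₁ refl | inj₂ refl | inj₁ refl = w≢y refl
    ... | inj₁ refl | inj₂ refl | inj₂ (inj₁ refl) = w≢z refl
    ... | inj₂ refl | inj₁ refl | inj₁ refl = w≢z refl
    ... | inj₂ refl | inj₁ refl | inj₂ (inj₁ refl) = w≢y refl

    -- The three inner vertices are core, too many for a double star. In a vase `x₁` or `x₃` is a
    -- base vertex, since only one of them can be the apex; the other is then a core vertex away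
    -- from it and its path neighbours.
    blocks⇒¬P5 : ¬ EdgeInducedSub (P 5) G
    blocks⇒¬P5 (f , f-inj , hom , _) with blocks e₁
      where e₁ = hom (suc zero) (suc (suc zero)) refl
    ... | γ , is , x₁∈ = impossible γ is (core γ is x₁∈ (E-sym e₀) e₁ (≢ λ ()))
                                    (core γ is x₂∈ (E-sym e₁) e₂ (≢ λ ()))
                                    (core γ is x₃∈ (E-sym e₂) e₃ (≢ λ ()))
      where
      ≢ : ∀ {i j} → i ≢ j → f i ≢ f j
      ≢ i≢j = i≢j ∘ f-inj
      e₀ = hom zero (suc zero) refl
      e₁ = hom (suc zero) (suc (suc zero)) refl
      e₂ = hom (suc (suc zero)) (suc (suc (suc zero))) refl
      e₃ = hom (suc (suc (suc zero))) (suc (suc (suc (suc zero)))) refl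
      x₂∈ = closed γ is x₁∈ e₁
      x₃∈ = closed γ is x₂∈ e₂
      impossible : ∀ γ → IsBlock γ → Core γ (f (suc zero)) → Core γ (f (suc (suc zero))) →
        Core γ (f (suc (suc (suc zero)))) → ⊥
      impossible (dstar _ _) is c₁ c₂ c₃ = ¬3-dstar c₁ c₂ c₃ (≢ λ ()) (≢ λ ()) (≢ λ ())
      impossible (vase _ _ _) is (inj₂ c₁) _ c₃ =
        ¬base is c₁ (E-sym e₀) e₁ (≢ λ ()) c₃ (≢ λ ()) (≢ λ ()) (≢ λ ())
      impossible (vase _ _ _) is c₁ _ (inj₂ c₃) =
        ¬base is c₃ e₃ (E-sym e₂) (≢ λ ()) c₁ (≢ λ ()) (≢ λ ()) (≢ λ ())
      impossible (vase _ _ _) is (inj₁ p) _ (inj₁ q) = ≢ (λ ()) (trans p (≡-sym q))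

    -- As for the path: one of `x₁`, `x₂` is a base vertex, and the opposite vertex of the cycle is
    -- a core vertex that it cannot accommodate.
    blocks⇒¬C4 : ¬ EdgeInducedSub C4 G
    blocks⇒¬C4 (f , f-inj , hom , _) with blocks e₁
      where e₁ = hom (suc zero) (suc (suc zero)) refl
    ... | γ , is , x₁∈ = impossible γ is (core γ is x₀∈ (E-sym e₃) e₀ (≢ λ ()))
                                    (core γ is x₁∈ (E-sym e₀) e₁ (≢ λ ()))
                                    (core γ is x₂∈ (E-sym e₁) e₂ (≢ λ ()))
                                    (core γ is x₃∈ (E-sym e₂) e₃ (≢ λ ()))
      where
      ≢ : ∀ {i j} → i ≢ j → f i ≢ f j
      ≢ i≢j = i≢j ∘ f-inj
      e₀ = hom zero (suc zero) refl
      e₁ = hom (suc zero) (suc (suc zero)) refl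
      e₂ = hom (suc (suc zero)) (suc (suc (suc zero))) refl
      e₃ = hom (suc (suc (suc zero))) zero refl
      x₂∈ = closed γ is x₁∈ e₁
      x₃∈ = closed γ is x₂∈ e₂
      x₀∈ = closed γ is x₃∈ e₃
      impossible : ∀ γ → IsBlock γ → Core γ (f zero) → Core γ (f (suc zero)) →
        Core γ (f (suc (suc zero))) → Core γ (f (suc (suc (suc zero)))) → ⊥
      impossible (dstar _ _) is c₀ c₁ c₂ _ = ¬3-dstar c₀ c₁ c₂ (≢ λ ()) (≢ λ ()) (≢ λ ())
      impossible (vase _ _ _) is _ (inj₂ c₁) _ c₃ =
        ¬base is c₁ (E-sym e₀) e₁ (≢ λ ()) c₃ (≢ λ ()) (≢ λ ()) (≢ λ ())
      impossible (vase _ _ _) is c₀ _ (inj₂ c₂) _ =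
        ¬base is c₂ (E-sym e₁) e₂ (≢ λ ()) c₀ (≢ λ ()) (≢ λ ()) (≢ λ ())
      impossible (vase _ _ _) is _ (inj₁ p) (inj₁ q) _ = ≢ (λ ()) (trans p (≡-sym q))

-- Blocks versus explicit vases and double stars

enumerate : ∀ {N} {Q : Fin N → Set} → Decidable Q →
  ∃ λ m → Σ (Fin m → Fin N) λ g →
    Injective _≡_ _≡_ g × (∀ i → Q (g i)) × (∀ {x} → Q x → ∃ λ i → g i ≡ x)
enumerate {N} Q? =
  length L , lookup L , lookup-injective (Unique.filter⁺ Q? (Unique.allFin⁺ N)) ,
  (λ i → proj₂ (∈-filter⁻ Q? {xs = allFin N} (∈-lookup i))) ,
  λ {x} q → let x∈ = ∈-filter⁺ Q? (∈-allFin x) q in index x∈ , ≡-sym (lookup-index x∈)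
  where L = filter Q? (allFin N)

data Split {m k} : Fin (m + k) → Set where
  left  : ∀ j → Split (j ↑ˡ k)
  right : ∀ j → Split (m ↑ʳ j)

split : ∀ m {k} (i : Fin (m + k)) → Split {m} {k} i
split m {k} i with splitAt m i in eq
... | inj₁ j = subst (Split {m} {k}) (splitAt⁻¹-↑ˡ eq) (left j)
... | inj₂ j = subst (Split {m} {k}) (splitAt⁻¹-↑ʳ {m} eq) (right j)

module _ (m k : ℕ) where

  leafˡ-0 : (j : Fin m) → adj (DoubleStar m k) zero (suc (suc (j ↑ˡ k))) ≡ true
  leafˡ-0 j rewrite toℕ-↑ˡ j k = trans (Bool.∨-identityʳ _) (dec-true (toℕ j <? m) (toℕ<n j))

  leafˡ-1 : (j : Fin m) → adj (DoubleStar m k) (suc zero) (suc (suc (j ↑ˡ k))) ≡ false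
  leafˡ-1 j rewrite toℕ-↑ˡ j k = trans (Bool.∨-identityʳ _)
    (cong (_∧ (toℕ j <ᵇ m + k)) (dec-false (m <? suc (toℕ j)) (≤⇒≯ (toℕ<n j))))

  leafʳ-0 : (j : Fin k) → adj (DoubleStar m k) zero (suc (suc (m ↑ʳ j))) ≡ false
  leafʳ-0 j rewrite toℕ-↑ʳ m j = trans (Bool.∨-identityʳ _)
    (dec-false (m + toℕ j <? m) (≤⇒≯ (m≤m+n m (toℕ j))))

  leafʳ-1 : (j : Fin k) → adj (DoubleStar m k) (suc zero) (suc (suc (m ↑ʳ j))) ≡ true
  leafʳ-1 j rewrite toℕ-↑ʳ m j = trans (Bool.∨-identityʳ _)
    (cong₂ _∧_ (dec-true (m <? suc (m + toℕ j)) (s≤s (m≤m+n m (toℕ j))))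
               (dec-true (m + toℕ j <? m + k) (+-monoʳ-< m (toℕ<n j))))

true≢false : ∀ {b} → b ≡ true → b ≢ false
true≢false refl ()

module Characterisation (G : Graph) where

  open Components G public

  ¬E⇒false : ∀ {u v} → ¬ E u v → adj G u v ≡ false
  ¬E⇒false = Bool.¬-not

  Reach-isolated : ∀ {u v} → ¬ ∃ (E u) → Reach G u v → u ≡ v
  Reach-isolated iso here = refl
  Reach-isolated iso (step r e) with refl ← Reach-isolated iso r = contradiction (_ , e) iso

  module _ {u} (H : Graph) (iso : ComponentIso G u H) where

    private
      f = proj₁ iso
      reach = proj₁ (proj₂ (proj₂ iso))
      onto = proj₁ (proj₂ (proj₂ (proj₂ iso)))
      adj≡ = proj₂ (proj₂ (proj₂ (proj₂ iso)))

    iso-edge : ∀ {i j} → adj H i j ≡ true → E (f i) (f j)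
    iso-edge = trans (≡-sym (adj≡ _ _))

    iso-neighbour : ∀ {i y} → E (f i) y → ∃ λ j → f j ≡ y × adj H i j ≡ true
    iso-neighbour {i} e with j , refl ← onto _ (step (reach i) e) = j , refl , trans (adj≡ _ _) e

    iso-∈ᵇ : ∀ γ → IsBlock γ → ∀ {i} → f i ∈ᵇ γ → u ∈ᵇ γ
    iso-∈ᵇ γ is fi∈ = closed-reach γ is fi∈ (reach-sym (reach _))

  vaseIso⇒Block : ∀ {u m} → ComponentIso G u (Vase m) → ∃ λ γ → IsBlock γ × u ∈ᵇ γ
  vaseIso⇒Block {u} {m} iso@(f , _) =
    vase a b c , isVase , iso-∈ᵇ H iso (vase a b c) isVase {zero} (inj₁ refl)
    where
    H = Vase m
    a = f zero
    b = f (suc zero)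
    c = f (suc (suc zero))
    isVase : IsVase a b c
    isVase = record
      { ab = iso-edge H iso refl
      ; ac = iso-edge H iso refl
      ; bc = iso-edge H iso refl
      ; Na = λ e → na (iso-neighbour H iso e)
      ; Nb = λ e → nb (iso-neighbour H iso e)
      ; Nc = λ e → nc (iso-neighbour H iso e)
      }
      where
      leaf : ∀ {i y} → (∃ λ j → f j ≡ y × adj H (suc (suc (suc i))) j ≡ true) → y ≡ a
      leaf (zero , refl , _) = refl
      leaf (suc zero , _ , ())
      leaf (suc (suc zero) , _ , ())
      leaf (suc (suc (suc _)) , _ , ())
      na : ∀ {x} → (∃ λ j → f j ≡ x × adj H zero j ≡ true) → x ≡ b ⊎ x ≡ c ⊎ Pendant a x
      na (zero , _ , ())
      na (suc zero , refl , _) = inj₁ refl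
      na (suc (suc zero) , refl , _) = inj₂ (inj₁ refl)
      na (suc (suc (suc i)) , refl , _) = inj₂ (inj₂ (λ e → leaf (iso-neighbour H iso e)))
      nb : ∀ {x} → (∃ λ j → f j ≡ x × adj H (suc zero) j ≡ true) → x ≡ a ⊎ x ≡ c
      nb (zero , refl , _) = inj₁ refl
      nb (suc zero , _ , ())
      nb (suc (suc zero) , refl , _) = inj₂ refl
      nb (suc (suc (suc _)) , _ , ())
      nc : ∀ {x} → (∃ λ j → f j ≡ x × adj H (suc (suc zero)) j ≡ true) → x ≡ a ⊎ x ≡ b
      nc (zero , refl , _) = inj₁ refl
      nc (suc zero , refl , _) = inj₂ refl
      nc (suc (suc zero) , _ , ())
      nc (suc (suc (suc _)) , _ , ())

  dstarIso⇒Block : ∀ {u m k} → ComponentIso G u (DoubleStar m k) → ∃ λ γ → IsBlock γ × u ∈ᵇ γ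
  dstarIso⇒Block {u} {m} {k} iso@(f , _) =
    dstar p q , isDS , iso-∈ᵇ H iso (dstar p q) isDS {zero} (inj₂ (E-sym pq))
    where
    H = DoubleStar m k
    p = f zero
    q = f (suc zero)
    pq : E p q
    pq = iso-edge H iso refl
    leafˡ : ∀ {y} i → (∃ λ j → f j ≡ y × adj H (suc (suc (i ↑ˡ k))) j ≡ true) → y ≡ p
    leafˡ i (zero , refl , _) = refl
    leafˡ i (suc zero , _ , e) = contradiction (leafˡ-1 m k i) (true≢false (trans (Graph.sym H (suc zero) (suc (suc (i ↑ˡ k)))) e))
    leafˡ i (suc (suc _) , _ , ())
    leafʳ : ∀ {y} i → (∃ λ j → f j ≡ y × adj H (suc (suc (m ↑ʳ i))) j ≡ true) → y ≡ q
    leafʳ i (zero , _ , e) = contradiction (leafʳ-0 m k i) (true≢false (trans (Graph.sym H zero (suc (suc (m ↑ʳ i)))) e))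
    leafʳ i (suc zero , refl , _) = refl
    leafʳ i (suc (suc _) , _ , ())
    np : ∀ {x} → (∃ λ j → f j ≡ x × adj H zero j ≡ true) → x ≡ q ⊎ Pendant p x
    np (zero , _ , ())
    np (suc zero , refl , _) = inj₁ refl
    np (suc (suc i) , refl , e) with split m i
    ... | left j = inj₂ (λ e → leafˡ j (iso-neighbour H iso e))
    ... | right j = contradiction (leafʳ-0 m k j) (true≢false e)
    nq : ∀ {x} → (∃ λ j → f j ≡ x × adj H (suc zero) j ≡ true) → x ≡ p ⊎ Pendant q x
    nq (zero , refl , _) = inj₁ refl
    nq (suc zero , _ , ())
    nq (suc (suc i) , refl , e) with split m i
    ... | left j = contradiction (leafˡ-1 m k j) (true≢false e)
    ... | right j = inj₂ (λ e → leafʳ j (iso-neighbour H iso e))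
    isDS : IsDoubleStar p q
    isDS = record
      { pq = pq ; Np = λ e → np (iso-neighbour H iso e) ; Nq = λ e → nq (iso-neighbour H iso e) }

  components⇒blocks : EveryComponentVaseDoubleStarOrK1 G → Blocks
  components⇒blocks comps {u} {v} uv with comps u
  ... | inj₁ (_ , iso) = vaseIso⇒Block iso
  ... | inj₂ (inj₁ (_ , _ , iso)) = dstarIso⇒Block iso
  -- A one-vertex component would identify the two ends of `uv`.
  ... | inj₂ (inj₂ (f , _ , _ , onto , _)) with onto u here | onto v (step here uv)
  ...   | zero , refl | zero , refl = contradiction uv E-irr

  vase⇒Iso : ∀ {a b c u} → IsVase a b c → u ∈ᵇ vase a b c → ∃ λ m → ComponentIso G u (Vase m)
  vase⇒Iso {a} {b} {c} {u} is u∈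
    with m , g , g-inj , g-extra , g-onto ← enumerate (λ x → E? a x ×-dec (¬? (x ≟ b) ×-dec ¬? (x ≟ c))) =
    m , f , f-inj , (λ i → connected γ is u∈ (f∈ i)) , (λ v r → f-onto (closed-reach γ is u∈ r)) , adj≡
    where
    open IsVase is
    γ = vase a b c
    f : Fin (3 + m) → V
    f zero = a
    f (suc zero) = b
    f (suc (suc zero)) = c
    f (suc (suc (suc i))) = g i
    ag : ∀ i → E a (g i)
    ag i = proj₁ (g-extra i)
    g≢b : ∀ i → g i ≢ b
    g≢b i = proj₁ (proj₂ (g-extra i))
    g≢c : ∀ i → g i ≢ c
    g≢c i = proj₂ (proj₂ (g-extra i))
    pendant : ∀ i → Pendant a (g i)
    pendant i with Na (ag i)
    ... | inj₁ eq = contradiction eq (g≢b i)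
    ... | inj₂ (inj₁ eq) = contradiction eq (g≢c i)
    ... | inj₂ (inj₂ pend) = pend
    f-inj : Injective _≡_ _≡_ f
    f-inj {zero} {zero} _ = refl
    f-inj {zero} {suc zero} eq = contradiction eq (E⇒≢ ab)
    f-inj {zero} {suc (suc zero)} eq = contradiction eq (E⇒≢ ac)
    f-inj {zero} {suc (suc (suc j))} eq = contradiction eq (E⇒≢ (ag j))
    f-inj {suc zero} {zero} eq = contradiction (≡-sym eq) (E⇒≢ ab)
    f-inj {suc zero} {suc zero} _ = refl
    f-inj {suc zero} {suc (suc zero)} eq = contradiction eq (E⇒≢ bc)
    f-inj {suc zero} {suc (suc (suc j))} eq = contradiction (≡-sym eq) (g≢b j)
    f-inj {suc (suc zero)} {zero} eq = contradiction (≡-sym eq) (E⇒≢ ac)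
    f-inj {suc (suc zero)} {suc zero} eq = contradiction (≡-sym eq) (E⇒≢ bc)
    f-inj {suc (suc zero)} {suc (suc zero)} _ = refl
    f-inj {suc (suc zero)} {suc (suc (suc j))} eq = contradiction (≡-sym eq) (g≢c j)
    f-inj {suc (suc (suc i))} {zero} eq = contradiction (≡-sym eq) (E⇒≢ (ag i))
    f-inj {suc (suc (suc i))} {suc zero} eq = contradiction eq (g≢b i)
    f-inj {suc (suc (suc i))} {suc (suc zero)} eq = contradiction eq (g≢c i)
    f-inj {suc (suc (suc i))} {suc (suc (suc j))} eq = cong (λ l → F.suc (F.suc (F.suc l))) (g-inj eq)
    f∈ : ∀ i → f i ∈ᵇ γ
    f∈ zero = inj₁ refl
    f∈ (suc zero) = inj₂ ab
    f∈ (suc (suc zero)) = inj₂ ac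
    f∈ (suc (suc (suc i))) = inj₂ (ag i)
    f-onto : ∀ {v} → v ∈ᵇ γ → ∃ λ i → f i ≡ v
    f-onto (inj₁ refl) = zero , refl
    f-onto {v} (inj₂ av) with v ≟ b | v ≟ c
    ... | yes refl | _ = suc zero , refl
    ... | no _ | yes refl = suc (suc zero) , refl
    ... | no v≢b | no v≢c with i , gi≡v ← g-onto (av , v≢b , v≢c) = suc (suc (suc i)) , gi≡v
    adj≡ : ∀ i j → adj (Vase m) i j ≡ adj G (f i) (f j)
    adj≡ zero zero = ≡-sym (irr G a)
    adj≡ zero (suc zero) = ≡-sym ab
    adj≡ zero (suc (suc zero)) = ≡-sym ac
    adj≡ zero (suc (suc (suc j))) = ≡-sym (ag j)
    adj≡ (suc zero) zero = ≡-sym (E-sym ab)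
    adj≡ (suc zero) (suc zero) = ≡-sym (irr G b)
    adj≡ (suc zero) (suc (suc zero)) = ≡-sym bc
    adj≡ (suc zero) (suc (suc (suc j))) = ≡-sym (¬E⇒false λ e → E⇒≢ ab (≡-sym (pendant j (E-sym e))))
    adj≡ (suc (suc zero)) zero = ≡-sym (E-sym ac)
    adj≡ (suc (suc zero)) (suc zero) = ≡-sym (E-sym bc)
    adj≡ (suc (suc zero)) (suc (suc zero)) = ≡-sym (irr G c)
    adj≡ (suc (suc zero)) (suc (suc (suc j))) = ≡-sym (¬E⇒false λ e → E⇒≢ ac (≡-sym (pendant j (E-sym e))))
    adj≡ (suc (suc (suc i))) zero = ≡-sym (E-sym (ag i))
    adj≡ (suc (suc (suc i))) (suc zero) = ≡-sym (¬E⇒false λ e → E⇒≢ ab (≡-sym (pendant i e)))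
    adj≡ (suc (suc (suc i))) (suc (suc zero)) = ≡-sym (¬E⇒false λ e → E⇒≢ ac (≡-sym (pendant i e)))
    adj≡ (suc (suc (suc i))) (suc (suc (suc j))) = ≡-sym (¬E⇒false λ e → E⇒≢ (ag j) (≡-sym (pendant i e)))

  dstar⇒Iso : ∀ {p q u} → IsDoubleStar p q → u ∈ᵇ dstar p q →
    ∃ λ m → ∃ λ k → ComponentIso G u (DoubleStar m k)
  dstar⇒Iso {p} {q} {u} is u∈
    with m , g , g-inj , g-leaf , g-onto ← enumerate (λ x → E? p x ×-dec ¬? (x ≟ q))
       | k , h , h-inj , h-leaf , h-onto ← enumerate (λ x → E? q x ×-dec ¬? (x ≟ p)) =
    m , k , f , f-inj , (λ i → connected γ is u∈ (f∈ i)) , (λ v r → f-onto (closed-reach γ is u∈ r)) , adj≡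
    where
    open IsDoubleStar is
    γ = dstar p q
    H = DoubleStar m k
    leaf : Fin (m + k) → V
    leaf i = [ g , h ]′ (splitAt m i)
    leaf-ˡ : ∀ j → leaf (j ↑ˡ k) ≡ g j
    leaf-ˡ j = cong [ g , h ]′ (splitAt-↑ˡ m j k)
    leaf-ʳ : ∀ j → leaf (m ↑ʳ j) ≡ h j
    leaf-ʳ j = cong [ g , h ]′ (splitAt-↑ʳ m k j)
    f : Fin (2 + m + k) → V
    f zero = p
    f (suc zero) = q
    f (suc (suc i)) = leaf i
    pg : ∀ j → E p (g j)
    pg j = proj₁ (g-leaf j)
    qh : ∀ j → E q (h j)
    qh j = proj₁ (h-leaf j)
    pendantˡ : ∀ j → Pendant p (g j)
    pendantˡ j with Np (pg j)
    ... | inj₁ eq = contradiction eq (proj₂ (g-leaf j))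
    ... | inj₂ pend = pend
    pendantʳ : ∀ j → Pendant q (h j)
    pendantʳ j with Nq (qh j)
    ... | inj₁ eq = contradiction eq (proj₂ (h-leaf j))
    ... | inj₂ pend = pend
    -- A common leaf would be pendant at `q` and yet adjacent to `p`.
    g≢h : ∀ i j → g i ≢ h j
    g≢h i j eq = E⇒≢ pq (pendantʳ j (E-sym (subst (E p) eq (pg i))))
    leaf≢ : ∀ i → leaf i ≢ p × leaf i ≢ q
    leaf≢ i with split m i
    ... | left j rewrite leaf-ˡ j = E⇒≢ (E-sym (pg j)) , proj₂ (g-leaf j)
    ... | right j rewrite leaf-ʳ j = proj₂ (h-leaf j) , E⇒≢ (E-sym (qh j))
    leaf-inj : Injective _≡_ _≡_ leaf
    leaf-inj {i} {j} eq with split m i | split m j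
    ... | left i | left j rewrite leaf-ˡ i | leaf-ˡ j = cong (_↑ˡ k) (g-inj eq)
    ... | left i | right j rewrite leaf-ˡ i | leaf-ʳ j = contradiction eq (g≢h i j)
    ... | right i | left j rewrite leaf-ʳ i | leaf-ˡ j = contradiction (≡-sym eq) (g≢h j i)
    ... | right i | right j rewrite leaf-ʳ i | leaf-ʳ j = cong (m ↑ʳ_) (h-inj eq)
    f-inj : Injective _≡_ _≡_ f
    f-inj {zero} {zero} _ = refl
    f-inj {zero} {suc zero} eq = contradiction eq (E⇒≢ pq)
    f-inj {zero} {suc (suc j)} eq = contradiction (≡-sym eq) (proj₁ (leaf≢ j))
    f-inj {suc zero} {zero} eq = contradiction (≡-sym eq) (E⇒≢ pq)
    f-inj {suc zero} {suc zero} _ = refl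
    f-inj {suc zero} {suc (suc j)} eq = contradiction (≡-sym eq) (proj₂ (leaf≢ j))
    f-inj {suc (suc i)} {zero} eq = contradiction eq (proj₁ (leaf≢ i))
    f-inj {suc (suc i)} {suc zero} eq = contradiction eq (proj₂ (leaf≢ i))
    f-inj {suc (suc i)} {suc (suc j)} eq = cong (λ l → F.suc (F.suc l)) (leaf-inj eq)
    f∈ : ∀ i → f i ∈ᵇ γ
    f∈ zero = inj₂ (E-sym pq)
    f∈ (suc zero) = inj₁ pq
    f∈ (suc (suc i)) with split m i
    ... | left j rewrite leaf-ˡ j = inj₁ (pg j)
    ... | right j rewrite leaf-ʳ j = inj₂ (qh j)
    f-onto : ∀ {v} → v ∈ᵇ γ → ∃ λ i → f i ≡ v
    f-onto {v} (inj₁ pv) with v ≟ q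
    ... | yes refl = suc zero , refl
    ... | no v≢q with j , refl ← g-onto (pv , v≢q) = suc (suc (j ↑ˡ k)) , leaf-ˡ j
    f-onto {v} (inj₂ qv) with v ≟ p
    ... | yes refl = zero , refl
    ... | no v≢p with j , refl ← h-onto (qv , v≢p) = suc (suc (m ↑ʳ j)) , leaf-ʳ j
    leaf-leaf : ∀ i j → ¬ E (leaf i) (leaf j)
    leaf-leaf i j e with split m i
    ... | left i′ rewrite leaf-ˡ i′ = proj₁ (leaf≢ j) (pendantˡ i′ e)
    ... | right i′ rewrite leaf-ʳ i′ = proj₂ (leaf≢ j) (pendantʳ i′ e)
    p-leaf : ∀ i → adj H zero (suc (suc i)) ≡ adj G p (leaf i)
    p-leaf i with split m i
    ... | left j rewrite leaf-ˡ j = trans (leafˡ-0 m k j) (≡-sym (pg j))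
    ... | right j rewrite leaf-ʳ j = trans (leafʳ-0 m k j)
      (≡-sym (¬E⇒false λ e → E⇒≢ pq (pendantʳ j (E-sym e))))
    q-leaf : ∀ i → adj H (suc zero) (suc (suc i)) ≡ adj G q (leaf i)
    q-leaf i with split m i
    ... | right j rewrite leaf-ʳ j = trans (leafʳ-1 m k j) (≡-sym (qh j))
    ... | left j rewrite leaf-ˡ j = trans (leafˡ-1 m k j)
      (≡-sym (¬E⇒false λ e → E⇒≢ pq (≡-sym (pendantˡ j (E-sym e)))))
    adj≡ : ∀ i j → adj H i j ≡ adj G (f i) (f j)
    adj≡ zero zero = ≡-sym (irr G p)
    adj≡ zero (suc zero) = ≡-sym pq
    adj≡ zero (suc (suc j)) = p-leaf j
    adj≡ (suc zero) zero = ≡-sym (E-sym pq)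
    adj≡ (suc zero) (suc zero) = trans (irr H (suc zero)) (≡-sym (irr G q))
    adj≡ (suc zero) (suc (suc j)) = q-leaf j
    adj≡ (suc (suc i)) zero =
      trans (Graph.sym H (suc (suc i)) zero) (trans (p-leaf i) (Graph.sym G p (leaf i)))
    adj≡ (suc (suc i)) (suc zero) =
      trans (Graph.sym H (suc (suc i)) (suc zero)) (trans (q-leaf i) (Graph.sym G q (leaf i)))
    adj≡ (suc (suc i)) (suc (suc j)) = ≡-sym (¬E⇒false (leaf-leaf i j))

  blocks⇒components : Blocks → EveryComponentVaseDoubleStarOrK1 G
  blocks⇒components blocks u with any? (E? u)
  ... | yes (v , uv) with blocks uv
  ...   | dstar p q , is , u∈ = inj₂ (inj₁ (dstar⇒Iso is u∈))
  ...   | vase a b c , is , u∈ = inj₁ (vase⇒Iso is u∈)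
  blocks⇒components blocks u | no isolated = inj₂ (inj₂
    ((λ _ → u) , (λ { {zero} {zero} _ → refl }) , (λ _ → here) ,
     (λ v r → zero , Reach-isolated isolated r) , λ { zero zero → ≡-sym (irr G u) }))

-- Alice's strategy

module Strategy (G : Graph) (k : ℕ)
  (ω≤k : ∀ es → IsEdgeClique G es → length es ≤ k) (block-of : Components.Blocks G) where

  open Components G
  open Colouring G k

  -- Positions of a component with Bob to move.  Leaf edges meet fewer than k other edges and are
  -- never in danger.  The spokes of a vase can no longer be spoiled once both are coloured (spokes),
  -- or the base edge shares a colour with an edge at the apex (matched), or there are no flowers
  -- (bare).
  data DStarState (p q : V) (c : Col G k) : Set where
    coloured  : ∀ {d} → c p q ≡ just d → DStarState p q c
    untouched : (∀ x → c p x ≡ nothing) → (∀ x → c q x ≡ nothing) → DStarState p q c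

  data VaseState (a b b′ : V) (c : Col G k) : Set where
    spokes    : ∀ {d e} → c a b ≡ just d → c a b′ ≡ just e → VaseState a b b′ c
    matched   : ∀ {d x} → c b b′ ≡ just d → c a x ≡ just d → VaseState a b b′ c
    bare      : (∀ {x} → E a x → x ≡ b ⊎ x ≡ b′) → VaseState a b b′ c
    untouched : (∀ x → c a x ≡ nothing) → (∀ x → c b x ≡ nothing) → (∀ x → c b′ x ≡ nothing) →
                VaseState a b b′ c
    oneSpoke  : ∀ {d} → c a b ≡ just d → (∀ {x} → x ≢ b → c a x ≡ nothing) →
                (∀ x → c b′ x ≡ nothing) → VaseState a b b′ c

  State : Block → Col G k → Set
  State (dstar p q)   = DStarState p q
  State (vase a b b′) = VaseState a b b′

  -- A state reads the colouring only in rows of vertices of its block, so moves in other components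
  -- preserve it.
  State-local : ∀ γ → IsBlock γ → ∀ {c c′} → (∀ {x} y → x ∈ᵇ γ → c′ x y ≡ c x y) →
    State γ c → State γ c′
  State-local (dstar p q) is same (coloured cpq) = coloured (trans (same q (inj₂ (E-sym pq))) cpq)
    where open IsDoubleStar is
  State-local (dstar p q) is same (untouched p∅ q∅) =
    untouched (λ x → trans (same x (inj₂ (E-sym pq))) (p∅ x)) (λ x → trans (same x (inj₁ pq)) (q∅ x))
    where open IsDoubleStar is
  State-local (vase a b b′) is {c} {c′} same s = go s
    where
    open IsVase is
    go : VaseState a b b′ c → VaseState a b b′ c′
    go (spokes p q) = spokes (trans (same b (inj₁ refl)) p) (trans (same b′ (inj₁ refl)) q)
    go (matched p q) = matched (trans (same b′ (inj₂ ab)) p) (trans (same _ (inj₁ refl)) q)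
    go (bare N) = bare N
    go (untouched p q r) = untouched (λ x → trans (same x (inj₁ refl)) (p x))
      (λ x → trans (same x (inj₂ ab)) (q x)) (λ x → trans (same x (inj₂ ac)) (r x))
    go (oneSpoke p q r) = oneSpoke (trans (same b (inj₁ refl)) p)
      (λ x≢b → trans (same _ (inj₁ refl)) (q x≢b)) (λ x → trans (same x (inj₂ ac)) (r x))

  data DStarEdge (p q u v : V) : Set where
    centre : SameEdge p q u v → DStarEdge p q u v
    leafˡ  : ∀ {l} → E p l → l ≢ q → Pendant p l → SameEdge p l u v → DStarEdge p q u v
    leafʳ  : ∀ {l} → E q l → l ≢ p → Pendant q l → SameEdge q l u v → DStarEdge p q u v

  dstarEdge : ∀ {p q u v} → IsDoubleStar p q → E u v → u ∈ᵇ dstar p q → DStarEdge p q u v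
  dstarEdge {p} {q} {u} {v} is uv (inj₁ pu) with u ≟ q
  ... | no u≢q with IsDoubleStar.Np is pu
  ...   | inj₁ u≡q = contradiction u≡q u≢q
  ...   | inj₂ pend = leafˡ pu u≢q pend (inj₂ (refl , pend uv))
  dstarEdge {p} {q} {u} {v} is uv (inj₁ pu) | yes refl with v ≟ p
  ...   | yes refl = centre (inj₂ (refl , refl))
  ...   | no v≢p with IsDoubleStar.Nq is uv
  ...     | inj₁ v≡p = contradiction v≡p v≢p
  ...     | inj₂ pend = leafʳ uv v≢p pend (inj₁ (refl , refl))
  dstarEdge {p} {q} {u} {v} is uv (inj₂ qu) with u ≟ p
  ... | no u≢p with IsDoubleStar.Nq is qu
  ...   | inj₁ u≡p = contradiction u≡p u≢p
  ...   | inj₂ pend = leafʳ qu u≢p pend (inj₂ (refl , pend uv))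
  dstarEdge {p} {q} {u} {v} is uv (inj₂ qu) | yes refl with v ≟ q
  ...   | yes refl = centre (inj₁ (refl , refl))
  ...   | no v≢q with IsDoubleStar.Np is uv
  ...     | inj₁ v≡q = contradiction v≡q v≢q
  ...     | inj₂ pend = leafˡ uv v≢q pend (inj₁ (refl , refl))

  data VaseEdge (a b b′ u v : V) : Set where
    base  : SameEdge b b′ u v → VaseEdge a b b′ u v
    at-a  : ∀ {l} → E a l → SameEdge a l u v → VaseEdge a b b′ u v

  vaseEdge : ∀ {a b b′ u v} → IsVase a b b′ → E u v → u ∈ᵇ vase a b b′ → VaseEdge a b b′ u v
  vaseEdge is uv (inj₁ refl) = at-a uv (inj₁ (refl , refl))
  vaseEdge is uv (inj₂ au) with IsVase.Na is au
  ... | inj₂ (inj₂ pend) = at-a au (inj₂ (refl , pend uv))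
  ... | inj₁ refl with IsVase.Nb is uv
  ...   | inj₁ refl = at-a au (inj₂ (refl , refl))
  ...   | inj₂ refl = base (inj₁ (refl , refl))
  vaseEdge is uv (inj₂ au) | inj₂ (inj₁ refl) with IsVase.Nc is uv
  ...   | inj₁ refl = at-a au (inj₂ (refl , refl))
  ...   | inj₂ refl = base (inj₂ (refl , refl))

  uncoloured : ∀ {c : Col G k} {x y a} → c x y ≡ nothing → c x y ≢ just a
  uncoloured {c} f p = just≢nothing {c} p f

  uncoloured-reorient : ∀ {c u v x y} → Proper c → SameEdge u v x y → c x y ≡ nothing → c u v ≡ nothing
  uncoloured-reorient pc (inj₁ (refl , refl)) f = f
  uncoloured-reorient pc (inj₂ (refl , refl)) f = trans (symm pc _ _) f

  step-reorient : ∀ {c u v x y a c′} → Proper c → SameEdge u v x y → Step c x y a c′ → Step c u v a c′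
  step-reorient pc (inj₁ (refl , refl)) s = s
  step-reorient pc (inj₂ (refl , refl)) s = step-swap pc s

  step-on : ∀ {c u v a c′} → Step c u v a c′ → c′ u v ≡ just a
  step-on s = on s (inj₁ (refl , refl))

  -- Alice's moves inside one component

  two≤ : ∀ {p x y} → E p x → E p y → x ≢ y → 2 ≤ k
  two≤ px py x≢y = star≤ ω≤k (_ ∷ _ ∷ []) ((x≢y ∷ []) ∷ [] ∷ []) (px ∷ py ∷ [])

  -- No colour is seen at `v`, whose only edge is the uncoloured `uv`.
  pendantStep : ∀ {c u v} → Proper c → E u v → Pendant u v → c u v ≡ nothing →
    ∃ λ a → ∃ λ m → Step c u v a (play c m)
  pendantStep {c} {u} {v} pc uv pend f = starStep ω≤k pc uv f λ p →
    contradiction (subst (λ w → c v w ≡ just _) (pend (onEdge pc p)) p)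
                  (uncoloured {c} (trans (symm pc v u) f))

  -- With both ends confined to the triangle, only `uw` and `vw` can restrict the edge, and three
  -- colours suffice.
  triangleStep : ∀ {c u v w} → Proper c → E u v → 3 ≤ k →
    (∀ {x} → E u x → x ≡ v ⊎ x ≡ w) → (∀ {x} → E v x → x ≡ u ⊎ x ≡ w) → c u v ≡ nothing →
    ∃ λ a → ∃ λ m → Step c u v a (play c m)
  triangleStep {c} {u} {v} {w} pc uv 3≤k Nu Nv f =
    listStep ω≤k pc uv f (c u w ∷ c v w ∷ []) 3≤k at-u at-v
    where
    at-u : ∀ {x a} → c u x ≡ just a → just a ∈ (c u w ∷ c v w ∷ [])
    at-u p with Nu (onEdge pc p)
    ... | inj₁ refl = contradiction p (uncoloured {c} f)
    ... | inj₂ refl = Any.here (≡-sym p)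
    at-v : ∀ {x a} → c v x ≡ just a → just a ∈ (c u w ∷ c v w ∷ [])
    at-v p with Nv (onEdge pc p)
    ... | inj₁ refl = contradiction p (uncoloured {c} (trans (symm pc v u) f))
    ... | inj₂ refl = Any.there (Any.here (≡-sym p))

  record Reply (γ : Block) (c : Col G k) : Set where
    constructor reply
    field
      {x y}  : V
      {d}    : Fin k
      m      : Move G k c
      played : Step c x y d (play c m)
      x∈     : x ∈ᵇ γ
      state  : State γ (play c m)

  -- Alice's move when nothing is forced. The uncoloured edge `uv` only shows that the block is
  -- unfinished: in an untouched or half-opened block she colours the centre edge or a spoke
  -- instead.
  freeMove : ∀ γ → IsBlock γ → ∀ {c u v} → Proper c → State γ c →
    E u v → u ∈ᵇ γ → c u v ≡ nothing → Reply γ c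
  freeMove (dstar p q) is {c} pc (coloured cpq) uv u∈ f with dstarEdge is uv u∈
  ... | centre e = contradiction cpq (uncoloured {c} (uncoloured-reorient pc e f))
  ... | leafˡ pl _ pend e with _ , m , s ← pendantStep pc pl pend (uncoloured-reorient pc e f) =
    reply m s (inj₂ (E-sym (IsDoubleStar.pq is))) (coloured (step-⊑ pc s cpq))
  ... | leafʳ ql _ pend e with _ , m , s ← pendantStep pc ql pend (uncoloured-reorient pc e f) =
    reply m s (inj₁ (IsDoubleStar.pq is)) (coloured (step-⊑ pc s cpq))
  freeMove (dstar p q) is {c} pc (untouched p∅ q∅) uv u∈ f
    with _ , m , s ← listStep ω≤k pc (IsDoubleStar.pq is) (p∅ q) []
           (star≤ ω≤k (q ∷ []) ([] ∷ []) (IsDoubleStar.pq is ∷ []))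
           (λ p → contradiction p (uncoloured {c} (p∅ _)))
           (λ p → contradiction p (uncoloured {c} (q∅ _))) =
    reply m s (inj₂ (E-sym (IsDoubleStar.pq is))) (coloured (step-on s))
  freeMove (vase a b b′) is {c} {u} {v} pc state uv u∈ f = go state
    where
    open IsVase is
    3≤k : 3 ≤ k
    3≤k = triangle≤ ω≤k ab bc ac

    baseMove : SameEdge b b′ u v → (∀ {c′} → c ⊑ c′ → VaseState a b b′ c′) → Reply (vase a b b′) c
    baseMove e keep
      with _ , m , s ← triangleStep pc bc 3≤k (swap ∘ Nb) (swap ∘ Nc) (uncoloured-reorient pc e f) =
      reply m s (inj₂ ab) (keep (step-⊑ pc s))

    spokeMove : ∀ {l} → (∀ {c′} → c ⊑ c′ → VaseState a b b′ c′) →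
      (∃ λ d → ∃ λ m → Step c a l d (play c m)) → Reply (vase a b b′) c
    spokeMove keep (_ , m , s) = reply m s (inj₁ refl) (keep (step-⊑ pc s))

    go : VaseState a b b′ c → Reply (vase a b b′) c
    go (spokes cab cab′) with vaseEdge is uv u∈
    ... | base e = baseMove e λ le → spokes (le cab) (le cab′)
    ... | at-a al e with uncoloured-reorient pc e f | Na al
    ...   | f′ | inj₁ refl = contradiction cab (uncoloured {c} f′)
    ...   | f′ | inj₂ (inj₁ refl) = contradiction cab′ (uncoloured {c} f′)
    ...   | f′ | inj₂ (inj₂ pend) = spokeMove (λ le → spokes (le cab) (le cab′)) (pendantStep pc al pend f′)
    go (matched {d} {x} cbb′ cax) with vaseEdge is uv u∈
    ... | base e = baseMove e λ le → matched (le cbb′) (le cax)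
    ... | at-a {l} al e = spokeMove (λ le → matched (le cbb′) (le cax)) (move-at al f′ (Na al))
      where
      f′ : c a l ≡ nothing
      f′ = uncoloured-reorient pc e f
      move-at : ∀ {l} → E a l → c a l ≡ nothing → l ≡ b ⊎ l ≡ b′ ⊎ Pendant a l →
        ∃ λ d → ∃ λ m → Step c a l d (play c m)
      -- The only colour seen at `b` is that of the base edge, and it recurs at the apex on `ax`; so
      -- the degree bound at `a` suffices.
      move-at _ f′ (inj₁ refl) = starStep ω≤k pc ab f′ at-b
        where
        at-b : ∀ {w e} → c b w ≡ just e → ∃ λ y → c a y ≡ just e
        at-b p with Nb (onEdge pc p)
        ... | inj₁ refl = contradiction p (uncoloured {c} (trans (symm pc _ _) f′))
        ... | inj₂ refl = x , trans cax (trans (≡-sym cbb′) p)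
      move-at _ f′ (inj₂ (inj₁ refl)) = starStep ω≤k pc ac f′ at-b′
        where
        at-b′ : ∀ {w e} → c b′ w ≡ just e → ∃ λ y → c a y ≡ just e
        at-b′ p with Nc (onEdge pc p)
        ... | inj₁ refl = contradiction p (uncoloured {c} (trans (symm pc _ _) f′))
        ... | inj₂ refl = x , trans cax (trans (≡-sym cbb′) (trans (symm pc _ _) p))
      move-at al f′ (inj₂ (inj₂ pend)) = pendantStep pc al pend f′
    go (bare N) with vaseEdge is uv u∈
    ... | base e = baseMove e λ _ → bare N
    ... | at-a al e with uncoloured-reorient pc e f | N al
    ...   | f′ | inj₁ refl = spokeMove (λ _ → bare N) (triangleStep pc ab 3≤k N Nb f′)
    ...   | f′ | inj₂ refl = spokeMove (λ _ → bare N) (triangleStep pc ac 3≤k (swap ∘ N) Nc f′)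
    go (untouched a∅ b∅ b′∅)
      with _ , m , s ← listStep ω≤k pc ab (a∅ b) [] (≤-trans (s≤s z≤n) 3≤k)
             (λ p → contradiction p (uncoloured {c} (a∅ _)))
             (λ p → contradiction p (uncoloured {c} (b∅ _))) =
      reply m s (inj₁ refl) (oneSpoke (step-on s)
        (λ x≢b → trans (off s λ { (inj₁ (_ , x≡b)) → x≢b x≡b ; (inj₂ (a≡b , _)) → E⇒≢ ab a≡b }) (a∅ _))
        (λ x → trans (off s λ { (inj₁ (b′≡a , _)) → E⇒≢ ac (≡-sym b′≡a)
                              ; (inj₂ (b′≡b , _)) → E⇒≢ bc (≡-sym b′≡b) }) (b′∅ x)))
    go (oneSpoke {d} cab a∅ b′∅) = second
      where
      at-a′ : ∀ {w e} → c a w ≡ just e → just e ∈ (just d ∷ [])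
      at-a′ {w} p with w ≟ b
      ... | yes refl = Any.here (trans (≡-sym p) cab)
      ... | no w≢b = contradiction p (uncoloured {c} (a∅ w≢b))
      second : Reply (vase a b b′) c
      second
        with _ , m , s ← listStep ω≤k pc ac (a∅ (E⇒≢ bc ∘ ≡-sym)) (just d ∷ []) (≤-trans (s≤s (s≤s z≤n)) 3≤k)
               at-a′ (λ p → contradiction p (uncoloured {c} (b′∅ _))) =
        reply m s (inj₁ refl) (spokes (step-⊑ pc s cab) (step-on s))

  -- Around the centre edge only the colour `d` just played by Bob can occur. Two colours exist
  -- because his leaf edge and the centre edge share an end.
  centreReply : ∀ {p q c x y d c′} → IsDoubleStar p q → Proper c →
    (∀ x → c p x ≡ nothing) → (∀ x → c q x ≡ nothing) →
    Step c x y d c′ → c′ p q ≡ nothing → 2 ≤ k → Reply (dstar p q) c′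
  centreReply {p} {q} {c} {d = d} {c′} is pc p∅ q∅ s f 2≤k =
    let _ , m , t = listStep ω≤k (step-proper pc s) (IsDoubleStar.pq is) f (just d ∷ []) 2≤k (only p∅) (only q∅)
    in reply m t (inj₂ (E-sym (IsDoubleStar.pq is))) (coloured (step-on t))
    where
    only : ∀ {z} → (∀ x → c z x ≡ nothing) → ∀ {w e} → c′ z w ≡ just e → just e ∈ (just d ∷ [])
    only z∅ p with step-cases s p
    ... | inj₁ (_ , refl) = Any.here refl
    ... | inj₂ p′ = contradiction p′ (uncoloured {c} (z∅ _))

  -- The left alternative means that Bob's move did no harm, so that Alice still owes a move and may
  -- make it in any component.
  respond : ∀ γ → IsBlock γ → ∀ {c x y d c′} → Proper c → State γ c →
    Step c x y d c′ → x ∈ᵇ γ → State γ c′ ⊎ Reply γ c′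
  respond (dstar p q) is pc (coloured cpq) s x∈ = inj₁ (coloured (step-⊑ pc s cpq))
  respond (dstar p q) is pc (untouched p∅ q∅) s x∈ with dstarEdge is (edge s) x∈
  ... | centre e = inj₁ (coloured (step-on (step-reorient pc e s)))
  ... | leafˡ pl l≢q _ e = inj₂ (centreReply is pc p∅ q∅ s
    (trans (off (step-reorient pc e s) λ { (inj₁ (_ , q≡l)) → l≢q (≡-sym q≡l)
                                         ; (inj₂ (p≡l , _)) → E⇒≢ pl p≡l }) (p∅ q))
    (two≤ pl (IsDoubleStar.pq is) l≢q))
  ... | leafʳ ql l≢p _ e = inj₂ (centreReply is pc p∅ q∅ s
    (trans (off (step-reorient pc e s) λ { (inj₁ (p≡q , _)) → E⇒≢ (IsDoubleStar.pq is) p≡q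
                                         ; (inj₂ (p≡l , _)) → l≢p (≡-sym p≡l) }) (p∅ q))
    (two≤ ql (E-sym (IsDoubleStar.pq is)) l≢p))
  respond (vase a b b′) is {c} {x} {y} {d} {c′} pc state s x∈ = go state
    where
    open IsVase is
    3≤k : 3 ≤ k
    3≤k = triangle≤ ω≤k ab bc ac
    pc′ : Proper c′
    pc′ = step-proper pc s

    old : ∀ {z w e} → c′ z w ≡ just e → c z w ≡ nothing → e ≡ d
    old p z∅ with step-cases s p
    ... | inj₁ (_ , e≡d) = e≡d
    ... | inj₂ p′ = contradiction p′ (uncoloured {c} z∅)

    only : ∀ {z} → (∀ w → c z w ≡ nothing) → ∀ {w e} → c′ z w ≡ just e → just e ∈ (just d ∷ [])
    only z∅ p = Any.here (cong just (old p (z∅ _)))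

    go : VaseState a b b′ c → VaseState a b b′ c′ ⊎ Reply (vase a b b′) c′
    go (spokes p q) = inj₁ (spokes (step-⊑ pc s p) (step-⊑ pc s q))
    go (matched p q) = inj₁ (matched (step-⊑ pc s p) (step-⊑ pc s q))
    go (bare N) = inj₁ (bare N)
    go (untouched a∅ b∅ b′∅) with vaseEdge is (edge s) x∈
    -- Without flowers the vase is a bare triangle and safe. Otherwise `d` is legal on any leaf
    -- edge, because nothing is coloured yet at the apex or at that leaf.
    ... | base e = baseAnswer (any? (λ l → E? a l ×-dec (¬? (l ≟ b) ×-dec ¬? (l ≟ b′))))
      where
      r : Step c b b′ d c′
      r = step-reorient pc e s
      off-base : ∀ {z w} → z ≢ b → z ≢ b′ → c′ z w ≡ c z w
      off-base z≢b z≢b′ = off r λ { (inj₁ (z≡b , _)) → z≢b z≡b ; (inj₂ (z≡b′ , _)) → z≢b′ z≡b′ }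
      ∅-at-a : ∀ w → c′ a w ≡ nothing
      ∅-at-a w = trans (off-base (E⇒≢ ab) (E⇒≢ ac)) (a∅ w)
      baseAnswer : Dec (∃ λ l → E a l × l ≢ b × l ≢ b′) → VaseState a b b′ c′ ⊎ Reply (vase a b b′) c′
      baseAnswer (no none) = inj₁ (bare (¬extra⇒N none))
      baseAnswer (yes (l , al , l≢b , l≢b′)) =
        let m , t = makeStep pc′ al (∅-at-a l) (λ w → uncoloured {c′} (∅-at-a w)) d-at-l
        in inj₂ (reply m t (inj₁ refl) (matched (step-⊑ pc′ t (step-on r)) (step-on t)))
        where
        d-at-l : ∀ w → c′ l w ≢ just d
        d-at-l w p with Na al
        ... | inj₁ l≡b = l≢b l≡b
        ... | inj₂ (inj₁ l≡b′) = l≢b′ l≡b′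
        ... | inj₂ (inj₂ pend) with refl ← pend (onEdge pc′ p) =
          uncoloured {c′} (∅-at-a l) (trans (symm pc′ a l) p)
    ... | at-a {l} al e = inj₂ (answer (Na al) (step-reorient pc e s))
      where
      answer : l ≡ b ⊎ l ≡ b′ ⊎ Pendant a l → Step c a l d c′ → Reply (vase a b b′) c′
      answer (inj₁ refl) r
        with _ , m , t ← listStep ω≤k pc′ ac
               (trans (off r λ { (inj₁ (_ , b′≡b)) → E⇒≢ bc (≡-sym b′≡b) ; (inj₂ (a≡b , _)) → E⇒≢ ab a≡b }) (a∅ b′))
               (just d ∷ []) (≤-trans (s≤s (s≤s z≤n)) 3≤k) (only a∅) (only b′∅) =
        reply m t (inj₁ refl) (spokes (step-⊑ pc′ t (step-on r)) (step-on t))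
      answer (inj₂ (inj₁ refl)) r
        with _ , m , t ← listStep ω≤k pc′ ab
               (trans (off r λ { (inj₁ (_ , b≡b′)) → E⇒≢ bc b≡b′ ; (inj₂ (a≡b′ , _)) → E⇒≢ ac a≡b′ }) (a∅ b))
               (just d ∷ []) (≤-trans (s≤s (s≤s z≤n)) 3≤k) (only a∅) (only b∅) =
        reply m t (inj₁ refl) (spokes (step-on t) (step-⊑ pc′ t (step-on r)))
      -- Bob's leaf edge touches neither `b` nor `b′`, which are not pendant; hence his colour is
      -- legal on the base edge.
      answer (inj₂ (inj₂ pend)) r =
        let m , t = makeStep pc′ bc (∅-at b≢a b≢l b∅)
              (λ w → uncoloured {c′} (∅-at b≢a b≢l b∅)) (λ w → uncoloured {c′} (∅-at b′≢a b′≢l b′∅))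
        in reply m t (inj₂ ab) (matched (step-on t) (step-⊑ pc′ t (step-on r)))
        where
        b≢a : b ≢ a
        b≢a = E⇒≢ (E-sym ab)
        b′≢a : b′ ≢ a
        b′≢a = E⇒≢ (E-sym ac)
        b≢l : b ≢ l
        b≢l refl = b′≢a (pend bc)
        b′≢l : b′ ≢ l
        b′≢l refl = b≢a (pend (E-sym bc))
        ∅-at : ∀ {z w} → z ≢ a → z ≢ l → (∀ w → c z w ≡ nothing) → c′ z w ≡ nothing
        ∅-at z≢a z≢l z∅ = trans (off r λ { (inj₁ (z≡a , _)) → z≢a z≡a ; (inj₂ (z≡l , _)) → z≢l z≡l }) (z∅ _)
    -- If Bob has not coloured the second spoke himself, it meets only `d₀` and possibly his `d`.
    go (oneSpoke {d₀} cab a∅ b′∅) with sameEdge? x y a b′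
    ... | yes e = inj₁ (spokes (step-⊑ pc s cab) (on s e))
    ... | no ¬e = inj₂ second
      where
      at-a′ : ∀ {w e} → c′ a w ≡ just e → just e ∈ (just d ∷ just d₀ ∷ [])
      at-a′ {w} p with w ≟ b
      ... | yes refl = Any.there (Any.here (trans (≡-sym p) (step-⊑ pc s cab)))
      ... | no w≢b = Any.here (cong just (old p (a∅ w≢b)))
      second : Reply (vase a b b′) c′
      second
        with _ , m , t ← listStep ω≤k pc′ ac (trans (off s ¬e) (a∅ (E⇒≢ bc ∘ ≡-sym)))
               (just d ∷ just d₀ ∷ []) 3≤k at-a′ (λ p → Any.here (cong just (old p (b′∅ _)))) =
        reply m t (inj₁ refl) (spokes (step-⊑ pc′ t (step-⊑ pc s cab)) (step-on t))

  -- The invariant over all components and the course of the game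

  Good : Col G k → Set
  Good c = ∀ {u v} → E u v → ∃ λ γ → IsBlock γ × u ∈ᵇ γ × State γ c

  -- A block through a vertex outside `γ` is disjoint from `γ`, since a common vertex would connect
  -- them; there the old state survives.
  good-local : ∀ γ → IsBlock γ → ∀ {c c′} → Good c → State γ c′ →
    (∀ {x} y → ¬ x ∈ᵇ γ → c′ x y ≡ c x y) → Good c′
  good-local γ is good state same {u} uv with u ∈ᵇ? γ
  ... | yes u∈ = γ , is , u∈ , state
  ... | no u∉ with γ′ , is′ , u∈′ , state′ ← good uv =
    γ′ , is′ , u∈′ , State-local γ′ is′ (λ y x∈′ → same y λ x∈ →
      u∉ (closed-reach γ is x∈ (connected γ′ is′ x∈′ u∈′))) state′

  step-outside : ∀ γ → IsBlock γ → ∀ {c u v a c′} → Step c u v a c′ → u ∈ᵇ γ →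
    ∀ {x} y → ¬ x ∈ᵇ γ → c′ x y ≡ c x y
  step-outside γ is s u∈ y x∉ = off s λ
    { (inj₁ (refl , _)) → x∉ u∈ ; (inj₂ (refl , _)) → x∉ (closed γ is u∈ (edge s)) }

  GoodMove : Col G k → Set
  GoodMove c = AllColoured {G} c ⊎ Σ (Move G k c) λ m → Good (play c m)

  aliceMove : ∀ {c} → Proper c → Good c → GoodMove c
  aliceMove {c} pc good with any? (λ u → any? (λ v → E? u v ×-dec Maybe-≡-dec _≟_ (c u v) nothing))
  ... | yes (u , v , uv , f) with γ , is , u∈ , state ← good uv
                              with reply m s x∈ state′ ← freeMove γ is pc state uv u∈ f =
    inj₂ (m , good-local γ is good state′ (step-outside γ is s x∈))
  aliceMove {c} pc good | no none = inj₁ all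
    where
    all : AllColoured {G} c
    all u v uv with c u v in eq
    ... | just a = a , refl
    ... | nothing = contradiction (u , v , uv , eq) none

  aliceReply : ∀ {c} → Proper c → Good c → (m : Move G k c) → GoodMove (play c m)
  aliceReply {c} pc good m with s ← play-step m
                            with γ , is , u∈ , state ← good (edge s)
                            with respond γ is pc state s u∈
  ... | inj₁ state′ = aliceMove (step-proper pc s) (good-local γ is good state′ (step-outside γ is s u∈))
  -- Between Bob's move and the reply the block may be in no safe state, so the position after both
  -- moves is compared with the one before both.
  ... | inj₂ (reply m′ s′ x∈ state′) = inj₂ (m′ , good-local γ is good state′ λ y x∉ →
    trans (step-outside γ is s′ x∈ y x∉) (step-outside γ is s u∈ y x∉))

  -- The list bounds the rest of the game: each move of Alice removes a pair from it, and Bob's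
  -- moves and skips never add one.
  Covers : List (V × V) → Col G k → Set
  Covers L c = ∀ {u v} → E u v → c u v ≡ nothing → (u , v) ∈ L

  ⊑-uncoloured : ∀ {c c′ x y} → c ⊑ c′ → c′ x y ≡ nothing → c x y ≡ nothing
  ⊑-uncoloured {c} {c′} {x} {y} le f with c x y in eq
  ... | nothing = refl
  ... | just b = contradiction (le eq) (uncoloured {c′} f)

  covers-play : ∀ {L c} → Proper c → Covers L c → (m : Move G k c) → Covers L (play c m)
  covers-play {c = c} pc cov m xy f =
    cov xy (⊑-uncoloured {c} {play c m} (step-⊑ pc (play-step m)) f)

  shrink : ∀ {L c} → Proper c → Covers L c → (m : Move G k c) →
    ∃ λ L′ → length L′ < length L × Covers L′ (play c m)
  shrink {L} {c} pc cov m =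
    filter ≢uv? L , filter-notAll ≢uv? L (Any.map (λ eq ne → ne eq) (cov (edge s) (fresh s))) ,
    λ {x} {y} xy f → ∈-filter⁺ ≢uv? (covers-play pc cov m xy f) λ { refl → uncoloured {play c m} {x} {y} f (step-on s) }
    where
    s = play-step m
    ≢uv? = λ e → ¬? (×-≡-dec _≟_ _≟_ (Move.u m , Move.v m) e)

  -- Induction on the bound `N` for the list of uncoloured pairs. The move Alice could make in Bob's
  -- place has two uses: it proves to `bTurn` that the game is not over, and it is her answer if Bob
  -- skips.
  bobTurn : ∀ N {L c} → length L < N → Proper c → Good c → Covers L c → Wins G k (just B) B c
  bobTurn (suc N) {L} {c} (s≤s L≤N) pc good cov with aliceMove pc good
  ... | inj₁ all = finished all
  ... | inj₂ (m , good′) = bTurn m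
    (λ m₁ → reply-with (step-proper pc (play-step m₁)) (covers-play pc cov m₁) (aliceReply pc good m₁))
    (λ _ → reply-with pc cov (inj₂ (m , good′)))
    where
    reply-with : ∀ {c} → Proper c → Covers L c → GoodMove c → Wins G k (just B) A c
    reply-with pc cov (inj₁ all) = finished all
    reply-with pc cov (inj₂ (m , good)) with _ , L′<L , cov′ ← shrink pc cov m =
      aMove m (bobTurn N (≤-trans L′<L L≤N) (step-proper pc (play-step m)) good cov′)

  alice-wins : AliceWins B (just B) G k
  alice-wins = bobTurn _ {cartesianProduct (allFin _) (allFin _)} (≤-reflexive refl) empty-proper good
    λ {u} {v} _ _ → ∈-cartesianProduct⁺ (∈-allFin u) (∈-allFin v)
    where
    good : Good (empty G k)
    good uv with block-of uv
    ... | dstar p q , is , u∈ = dstar p q , is , u∈ , untouched (λ _ → refl) (λ _ → refl)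
    ... | vase a b b′ , is , u∈ = vase a b b′ , is , u∈ , untouched (λ _ → refl) (λ _ → refl) (λ _ → refl)

-- Comparison of the games, and perfection from forbidden subgraphs

EdgeInducedSub-trans : ∀ {F H G} → EdgeInducedSub F H → EdgeInducedSub H G → EdgeInducedSub F G
EdgeInducedSub-trans (f , f-inj , f-hom , noniso) (g , g-inj , g-hom , _) =
  g ∘ f , f-inj ∘ g-inj , (λ i j → g-hom (f i) (f j) ∘ f-hom i j) , noniso

Wins-noSkip : ∀ {G k p c} → Wins G k (just B) p c → Wins G k nothing p c
Wins-noSkip (finished all) = finished all
Wins-noSkip (aMove m w) = aMove m (Wins-noSkip w)
Wins-noSkip (bTurn m w _) = bTurn m (λ m → Wins-noSkip (w m)) λ ()

Wins-skipFirst : ∀ {G k c} → Wins G k (just B) B c → Wins G k (just B) A c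
Wins-skipFirst (finished all) = finished all
Wins-skipFirst (bTurn _ _ skip) = skip refl

omega≤ : ∀ {X Y G j w} → AliceWins X Y G j → IsOmegaL G w → w ≤ j
omega≤ {G = G} {j} win ((es , clique , refl) , _)
  with _ , proper , all , _ ← Colouring.outcome G j win (Colouring.empty-proper G j) =
  Colouring.clique≤colours G j proper all clique

-- Only wins have to be transferred: that fewer than ω colours fail is `omega≤`, valid in every
-- variant.
LinePerfect-map : ∀ {X Y X′ Y′ G} → (∀ {H k} → AliceWins X Y H k → AliceWins X′ Y′ H k) →
  LinePerfect X Y G → LinePerfect X′ Y′ G
LinePerfect-map f perfect H sub w ω =
  f (proj₁ (perfect H sub w ω)) , λ j j<w win → <⇒≱ j<w (omega≤ win ω)

forbidden⇒perfect : ∀ {G} → ¬ EdgeInducedSub (P 5) G → ¬ EdgeInducedSub C4 G → LinePerfect B (just B) G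
forbidden⇒perfect {G} ¬P5 ¬C4 H sub w ω@(_ , ω≤w) =
  Strategy.alice-wins H w ω≤w
    (Components.¬P5¬C4⇒Blocks H (λ p → ¬P5 (EdgeInducedSub-trans {P 5} {H} {G} p sub))
                                (λ p → ¬C4 (EdgeInducedSub-trans {C4} {H} {G} p sub))) ,
  λ j j<w win → <⇒≱ j<w (omega≤ win ω)

-- Bob's win with two colours

module TwoColours (G : Graph) where

  open Edges G
  open Colouring G 2

  Extends : V → V → Set
  Extends x y = ∃ λ z → ∃ λ t → E y z × E z t × x ≢ z × y ≢ t

  extends? : ∀ x y → Dec (Extends x y)
  extends? x y = any? λ z → any? λ t → E? y z ×-dec (E? z t ×-dec (¬? (x ≟ z) ×-dec ¬? (y ≟ t)))

  opposite-≢ : (a : Fin 2) → opposite a ≢ a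
  opposite-≢ zero ()
  opposite-≢ (suc zero) ()

  two-colours : (a e : Fin 2) → e ≡ a ⊎ e ≡ opposite a
  two-colours zero zero = inj₁ refl
  two-colours zero (suc zero) = inj₂ refl
  two-colours (suc zero) zero = inj₂ refl
  two-colours (suc zero) (suc zero) = inj₁ refl

  -- After Alice colours xy, Bob gives zt the other colour, and yz can no longer be coloured.
  bob-spoils : ∀ {x y a c} → Step (empty G 2) x y a c → Extends x y → ¬ Wins G 2 nothing B c
  bob-spoils {x} {y} {a} {c} s (z , t , yz , zt , x≢z , y≢t) = λ
    { (finished all) → let _ , p = all z t zt in contradiction p (uncoloured {z} {t} czt)
    ; (bTurn _ w _) →
        let m , s′ = makeStep pc zt czt (λ w → free) (λ w → free)
            pc′ = step-proper pc s′
            c″ , pc″ , all , le = outcome (w m) pc′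
            e , p = all y z yz
        in stuck pc″ p (le (step-⊑ pc s′ (on s (inj₂ (refl , refl))))) (le (on s′ (inj₁ (refl , refl)))) }
    where
    pc : Proper c
    pc = step-proper empty-proper s
    czt : c z t ≡ nothing
    czt = off s λ { (inj₁ (z≡x , _)) → x≢z (≡-sym z≡x) ; (inj₂ (z≡y , _)) → E⇒≢ yz (≡-sym z≡y) }
    uncoloured : ∀ {u v e} → c u v ≡ nothing → c u v ≢ just e
    uncoloured {u} {v} f p = just≢nothing {c} {u} {v} p f
    free : ∀ {u w} → c u w ≢ just (opposite a)
    free p with step-cases s p
    ... | inj₁ (_ , eq) = opposite-≢ a eq
    stuck : ∀ {c e} → Proper c → c y z ≡ just e → c y x ≡ just a → c z t ≢ just (opposite a)
    stuck {c} {e} pc yz≡ yx≡ zt≡ with two-colours a e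
    ... | inj₁ refl = x≢z (inj pc yx≡ yz≡)
    ... | inj₂ refl = y≢t (inj pc (trans (symm pc z y) yz≡) zt≡)

  -- Alice has to start and cannot skip, so she must give Bob one of the extendable edges; the given
  -- edge ensures that the empty colouring is not already complete.
  bob-wins : (∃₂ E) → (∀ u v → E u v → Extends u v ⊎ Extends v u) → ¬ AliceWins A nothing G 2
  bob-wins (u , v , uv) ext (finished all) with all u v uv
  ... | _ , ()
  bob-wins _ ext (aMove m w) with s ← play-step m with ext _ _ (edge s)
  ... | inj₁ uv = bob-spoils s uv w
  ... | inj₂ vu = bob-spoils (step-swap empty-proper s) vu w

  -- On P₅ and C₄, numbered along the path or cycle, this alternates between the two colours.
  code : V → V → Fin 2
  code x y = ((toℕ x + toℕ y) / 2) mod 2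

  codeColouring : Col G 2
  codeColouring x y = if adj G x y then just (code x y) else nothing

  codeColouring-E : ∀ {x y} → E x y → codeColouring x y ≡ just (code x y)
  codeColouring-E e rewrite e = refl

  codeColouring-just : ∀ {x y a} → codeColouring x y ≡ just a → E x y × code x y ≡ a
  codeColouring-just {x} {y} p with adj G x y
  codeColouring-just refl | true = refl , refl

  CodeInjective : Set
  CodeInjective = ∀ x y z → E x y → E x z → code x y ≡ code x z → y ≡ z

  codeInjective? : Dec CodeInjective
  codeInjective? = all? λ x → all? λ y → all? λ z →
    E? x y →-dec (E? x z →-dec (code x y ≟ code x z →-dec y ≟ z))

  extendable? : Dec (∀ u v → E u v → Extends u v ⊎ Extends v u)
  extendable? = all? λ u → all? λ v → E? u v →-dec (extends? u v ⊎-dec extends? v u)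

  -- A proper 2-colouring bounds all cliques of the line graph at once, without listing them.
  code-omega≤ : CodeInjective → ∀ es → IsEdgeClique G es → length es ≤ 2
  code-omega≤ code-inj es = clique≤colours {codeColouring} proper (λ _ _ e → _ , codeColouring-E e)
    where
    proper : Proper codeColouring
    proper = record
      { symm = λ x y → cong₂ (λ b s → if b then just ((s / 2) mod 2) else nothing)
                             (Graph.sym G x y) (+-comm (toℕ x) (toℕ y))
      ; onEdge = proj₁ ∘ codeColouring-just
      ; inj = λ p q → let e , p′ = codeColouring-just p ; e′ , q′ = codeColouring-just q
                      in code-inj _ _ _ e e′ (trans p′ (≡-sym q′))
      }

  omega≡2 : CodeInjective → ∀ {u v w} → E v u → E v w → u ≢ w → IsOmegaL G 2
  omega≡2 code-inj vu vw u≢w =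
    (_ , star-isEdgeClique ((u≢w ∷ []) ∷ [] ∷ []) (vu ∷ vw ∷ []) , refl) , code-omega≤ code-inj

¬perfect : ∀ {F G} → IsOmegaL F 2 → ¬ AliceWins A nothing F 2 →
  LinePerfect A nothing G → ¬ EdgeInducedSub F G
¬perfect {F} ω lose perfect sub = lose (proj₁ (perfect F sub 2 ω))

perfect⇒¬P5 : ∀ {G} → LinePerfect A nothing G → ¬ EdgeInducedSub (P 5) G
perfect⇒¬P5 {G} = ¬perfect {P 5} {G}
  -- Both finite conditions on the five vertices are settled by evaluating their decision
  -- procedures.
  (omega≡2 (from-yes codeInjective?) {zero} {suc zero} {suc (suc zero)} refl refl λ ())
  (bob-wins (zero , suc zero , refl) (from-yes extendable?))
  where open TwoColours (P 5)

perfect⇒¬C4 : ∀ {G} → LinePerfect A nothing G → ¬ EdgeInducedSub C4 G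
perfect⇒¬C4 {G} = ¬perfect {C4} {G}
  (omega≡2 (from-yes codeInjective?) {zero} {suc zero} {suc (suc zero)} refl refl λ ())
  (bob-wins (zero , suc zero , refl) (from-yes extendable?))
  where open TwoColours C4

theorem12 : (G : Graph) →
    (LinePerfect B (just B) G ⇔ LinePerfect A (just B) G)
    × (LinePerfect A (just B) G ⇔ LinePerfect A nothing G)
    × (LinePerfect A nothing G
    ⇔ (¬ EdgeInducedSub (P 5) G × ¬ EdgeInducedSub C4 G))
    × ((¬ EdgeInducedSub (P 5) G × ¬ EdgeInducedSub C4 G)
    ⇔ EveryComponentVaseDoubleStarOrK1 G)
theorem12 G =
    mk⇔ 1⇒2 (4⇒1 ∘ 3⇒4 ∘ 2⇒3)
  , mk⇔ 2⇒3 (1⇒2 ∘ 4⇒1 ∘ 3⇒4)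
  , mk⇔ 3⇒4 (2⇒3 ∘ 1⇒2 ∘ 4⇒1)
  , mk⇔ (λ (¬P5 , ¬C4) → blocks⇒components (¬P5¬C4⇒Blocks ¬P5 ¬C4))
        (λ comps → let bs = components⇒blocks comps in blocks⇒¬P5 bs , blocks⇒¬C4 bs)
  where
  open Characterisation G
  1⇒2 : LinePerfect B (just B) G → LinePerfect A (just B) G
  1⇒2 = LinePerfect-map {G = G} Wins-skipFirst
  2⇒3 : LinePerfect A (just B) G → LinePerfect A nothing G
  2⇒3 = LinePerfect-map {G = G} Wins-noSkip
  3⇒4 : LinePerfect A nothing G → ¬ EdgeInducedSub (P 5) G × ¬ EdgeInducedSub C4 G
  3⇒4 perfect = perfect⇒¬P5 {G} perfect , perfect⇒¬C4 {G} perfect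
  4⇒1 : ¬ EdgeInducedSub (P 5) G × ¬ EdgeInducedSub C4 G → LinePerfect B (just B) G
  4⇒1 (¬P5 , ¬C4) = forbidden⇒perfect {G} ¬P5 ¬C4
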